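{- There exists a test which, given parameters $\delta\in(0,1)$ and $\epsilon>0$ and sample access to two distributions $\mathbf{p}$ and $\mathbf{q}$ over a set of $n$ elements, has running time $O(\epsilon^{ -4}\log(1/\delta))$ (with no dependence on $n$) and satisfies: (1) if $\|\mathbf{p}-\mathbf{q}\|_2\le\epsilon/2$, then the test accepts with probability at least $1-\delta$; (2) if $\|\mathbf{p}-\mathbf{q}\|_2>\epsilon$, then the test rejects with probability at least $1-\delta$.
   Context: A distribution over $n$ elements (labelled by $[n]=\{1,\dots,n\}$) is a vector $\mathbf{p}=(p_1,\dots,p_n)$ with $p_i$ the probability of outputting $i$; $\|\mathbf{v}\|_2=\sqrt{\sum_i v_i^2}$. A test is a randomized algorithm that outputs accept or reject. Its only access to $\mathbf{p}$ and $\mathbf{q}$ is through black boxes: each query to a black box returns (at unit cost) an independent sample from the corresponding distribution. Elements of $[n]$ can be stored and used as array indices at unit cost. The constants hidden in $O(\cdot)$ are absolute.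
   Formalization: The running time is bounded by C(1 + ε⁻⁴ log(1/δ)), with C absolute, instead of C ε⁻⁴ log(1/δ): the latter tends to 0 as δ→1 or ε→∞, while any test takes at least one step. -}

module Defs where

open import Level using (0ℓ)
open import Algebra.Bundles using (CommutativeRing; Semiring)
open import Algebra.Structures using (IsCommutativeRing)
import Algebra.Definitions.RawSemiring as RawSemiringDefinitions
open import Data.Bool.Base using (Bool; true; false; if_then_else_)
open import Data.Fin.Base using (Fin; toℕ)
open import Data.List.Base as List using (List; []; _∷_; [_]; _++_; concatMap)
open import Data.List.Relation.Unary.All using (All)
open import Data.Nat.Base as ℕ using (ℕ; zero; suc; _∸_; _≡ᵇ_; _<ᵇ_; _!)
open import Data.Product.Base using (∃-syntax; _×_; _,_)
open import Data.Vec.Functional using (Vector)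
open import Relation.Binary.Core using (Rel)
open import Relation.Binary.Structures using (IsDecTotalOrder)
open import Relation.Nullary.Decidable.Core using (does)
open import Relation.Nullary.Negation.Core using (¬_)

------------------------------------------------------------------------
-- The real numbers, axiomatised as a complete ordered field

-- `sup P` is unconstrained unless P is inhabited and bounded above, and
-- `0# ⁻¹` is unconstrained.  The order is decidable: these are the classical
-- reals.  `sup-approx` says in positive form that nothing below `sup P` is an
-- upper bound of P; classically it is equivalent to leastness.

record Reals : Set₁ where
  infix  8 _⁻¹
  infix  8 -_
  infixl 7 _*_
  infixl 6 _+_
  infix  4 _≈_ _≤_
  field
    Carrier : Set
    _≈_ _≤_ : Rel Carrier 0ℓ
    _+_ _*_ : Carrier → Carrier → Carrier
    -_ _⁻¹  : Carrier → Carrier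
    0# 1#   : Carrier
    sup     : (Carrier → Set) → Carrier

    isCommutativeRing : IsCommutativeRing _≈_ _+_ _*_ -_ 0# 1#
    0≉1               : ¬ (0# ≈ 1#)
    ⁻¹-cong           : ∀ {x y} → x ≈ y → x ⁻¹ ≈ y ⁻¹
    ⁻¹-inverse        : ∀ {x} → ¬ (x ≈ 0#) → x * x ⁻¹ ≈ 1#

    isDecTotalOrder   : IsDecTotalOrder _≈_ _≤_
    +-monoʳ-≤         : ∀ x {y z} → y ≤ z → x + y ≤ x + z
    *-nonNegative     : ∀ {x y} → 0# ≤ x → 0# ≤ y → 0# ≤ x * y

  UpperBound : (Carrier → Set) → Carrier → Set
  UpperBound P b = ∀ x → P x → x ≤ b

  field
    sup-upper  : ∀ P → (∃[ x ] P x) → (∃[ b ] UpperBound P b) →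
                 UpperBound P (sup P)
    sup-approx : ∀ P → (∃[ x ] P x) → (∃[ b ] UpperBound P b) →
                 ∀ b → ¬ (sup P ≤ b) → ∃[ x ] (P x × ¬ (x ≤ b))

  commutativeRing : CommutativeRing 0ℓ 0ℓ
  commutativeRing = record { isCommutativeRing = isCommutativeRing }

  open CommutativeRing commutativeRing public using (_-_; semiring)
  open Semiring semiring using (rawSemiring)
  open RawSemiringDefinitions rawSemiring public using (_^_; sum)
  open RawSemiringDefinitions rawSemiring using () renaming (_×_ to _·_)
  open IsDecTotalOrder isDecTotalOrder public using (_≤?_)

  infix 4 _<_
  _<_ : Rel Carrier 0ℓ
  x < y = ¬ (y ≤ x)

  infixl 7 _/_
  _/_ : Carrier → Carrier → Carrier
  x / y = x * y ⁻¹

  fromℕ : ℕ → Carrier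
  fromℕ k = k · 1#

  -- For x ≥ 0.
  √ : Carrier → Carrier
  √ x = sup (λ y → y * y ≤ x)

  expSum : Carrier → ℕ → Carrier
  expSum x N = sum {N} (λ k → x ^ toℕ k / fromℕ (toℕ k !))

  -- For x ≥ 0, where the partial sums of Σ xᵏ / k! increase to their limit.
  exp : Carrier → Carrier
  exp x = sup (λ s → ∃[ N ] s ≈ expSum x N)

  -- The natural logarithm, for x ≥ 1.
  log : Carrier → Carrier
  log x = sup (λ y → 0# ≤ y × exp y ≤ x)

  ‖_‖₂ : ∀ {n} → Vector Carrier n → Carrier
  ‖ v ‖₂ = √ (sum (λ i → v i ^ 2))

------------------------------------------------------------------------
-- Randomised algorithms: programs for a unit-cost random access machine
-- with natural-number registers, real registers and arrays of naturals,
-- which may query two black boxes and flip fair coins.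

data Verdict : Set where
  accept reject : Verdict

data BlackBox : Set where
  box-p box-q : BlackBox

NatReg RealReg Array : Set
NatReg  = ℕ
RealReg = ℕ
Array   = ℕ

-- The first register of an instruction is its destination, except in
-- `store`.  The only constants are naturals, so a program cannot have real
-- numbers hard-wired into it.
data Instr : Set where
  constₙ              : NatReg → ℕ → Instr
  addₙ subₙ           : NatReg → NatReg → NatReg → Instr
  load                : NatReg → Array → NatReg → Instr      -- x := A[y]
  store               : Array → NatReg → NatReg → Instr      -- A[x] := y
  constᵣ              : RealReg → ℕ → Instr
  addᵣ subᵣ mulᵣ divᵣ : RealReg → RealReg → RealReg → Instr
  castᵣ               : RealReg → NatReg → Instr
  query               : BlackBox → NatReg → Instr
  flip                : NatReg → Instr                       -- x := 0 or 1

data Cond : Set where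
  _=ₙ_ _<ₙ_ : NatReg → NatReg → Cond
  _≤ᵣ_      : RealReg → RealReg → Cond

data Command : Set where
  exec   : Instr → Command
  cond   : Cond → List Command → List Command → Command
  while  : Cond → List Command → Command
  output : Verdict → Command

Program : Set
Program = List Command

_[_≔_] : {A : Set} → (ℕ → A) → ℕ → A → (ℕ → A)
(f [ x ≔ a ]) y = if x ≡ᵇ y then a else f y

module Semantics (ℝ : Reals) where
  open Reals ℝ

  -- A probability vector on n elements.
  record Distribution (n : ℕ) : Set where
    field
      prob        : Vector Carrier n
      nonNegative : ∀ i → 0# ≤ prob i
      total       : sum prob ≈ 1#
  open Distribution public

  -- Finitely supported weights on a type; outcomes may be repeated.
  Dist : Set → Set
  Dist A = List (Carrier × A)

  pure : {A : Set} → A → Dist A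
  pure a = [ 1# , a ]

  infixl 1 _>>=_
  _>>=_ : {A B : Set} → Dist A → (A → Dist B) → Dist B
  d >>= k = concatMap (λ (w , a) → List.map (λ (v , b) → w * v , b) (k a)) d

  expectation : {A : Set} → (A → Carrier) → Dist A → Carrier
  expectation f d = List.foldr (λ (w , a) s → w * f a + s) 0# d

  record State : Set where
    constructor mkState
    field
      nat   : ℕ → ℕ
      real  : ℕ → Carrier
      array : ℕ → ℕ → ℕ
  open State public

  setNat : State → NatReg → ℕ → State
  setNat s x k = record s { nat = nat s [ x ≔ k ] }

  setReal : State → RealReg → Carrier → State
  setReal s x r = record s { real = real s [ x ≔ r ] }

  holds : Cond → State → Bool
  holds (x =ₙ y) s = nat s x ≡ᵇ nat s y
  holds (x <ₙ y) s = nat s x <ᵇ nat s y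
  holds (x ≤ᵣ y) s = does (real s x ≤? real s y)

  data Config : Set where
    running : Program → State → Config
    halted  : Verdict → Config

  data Halted : Config → Set where
    halted : ∀ v → Halted (halted v)

  outputs : Verdict → Config → Carrier
  outputs accept (halted accept) = 1#
  outputs reject (halted reject) = 1#
  outputs _      _               = 0#

  -- The parameters are passed in the first two real registers.
  initial : Program → (ε δ : Carrier) → Config
  initial test ε δ =
    running test (mkState (λ _ → 0) (((λ _ → 0#) [ 0 ≔ ε ]) [ 1 ≔ δ ]) (λ _ _ → 0))

  module Run {n : ℕ} (p q : Distribution n) where

    box : BlackBox → Distribution n
    box box-p = p
    box box-q = q

    -- Elements are labelled 1, …, n.
    sample : Distribution n → Dist ℕ
    sample d = List.tabulate (λ i → prob d i , suc (toℕ i))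

    coin : Dist ℕ
    coin = (1# / fromℕ 2 , 0) ∷ (1# / fromℕ 2 , 1) ∷ []

    execute : Instr → State → Dist State
    execute (constₙ x k)  s = pure (setNat s x k)
    execute (addₙ x y z)  s = pure (setNat s x (nat s y ℕ.+ nat s z))
    execute (subₙ x y z)  s = pure (setNat s x (nat s y ∸ nat s z))
    execute (load x A y)  s = pure (setNat s x (array s A (nat s y)))
    execute (store A x y) s =
      pure (record s { array = array s [ A ≔ array s A [ nat s x ≔ nat s y ] ] })
    execute (constᵣ x k)  s = pure (setReal s x (fromℕ k))
    execute (addᵣ x y z)  s = pure (setReal s x (real s y + real s z))
    execute (subᵣ x y z)  s = pure (setReal s x (real s y - real s z))
    execute (mulᵣ x y z)  s = pure (setReal s x (real s y * real s z))
    execute (divᵣ x y z)  s = pure (setReal s x (real s y / real s z))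
    execute (castᵣ x y)   s = pure (setReal s x (fromℕ (nat s y)))
    execute (query b x)   s = sample (box b) >>= λ i → pure (setNat s x i)
    execute (flip x)      s = coin >>= λ i → pure (setNat s x i)

    -- One unit of time.  A program that runs off its end never halts.
    step : Config → Dist Config
    step (halted v)                     = pure (halted v)
    step (running [] s)                 = pure (running [] s)
    step (running (exec i ∷ cs) s)      = execute i s >>= λ s′ → pure (running cs s′)
    step (running (cond b t e ∷ cs) s)  =
      pure (running ((if holds b s then t else e) ++ cs) s)
    step (running (while b t ∷ cs) s)   =
      pure (running (if holds b s then t ++ while b t ∷ cs else cs) s)
    step (running (output v ∷ cs) s)    = pure (halted v)

    run : ℕ → Config → Dist Config
    run zero    c = pure c
    run (suc t) c = step c >>= run t

    -- Worst case: over all coin flips and all answers of the black boxes.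
    HaltsWithin : ℕ → Config → Set
    HaltsWithin t c = All (λ (_ , c′) → Halted c′) (run t c)

    -- The probability of having halted with verdict v after at most t steps.
    Pr[_within_] : Verdict → ℕ → Config → Carrier
    Pr[ v within t ] c = expectation (outputs v) (run t c)

{-# OPTIONS --safe #-}

-- Draw x, x′ from p and y, y′ from q, and put Z = [x = x′] + [y = y′] - 2 [x = y].  Then
-- 𝔼 Z = ‖p - q‖₂² =: D whatever n is, so with μ = ε² / 128 the factor 1 + μ (Z - 80μ) has mean
-- at most ρ = 1 - 16μ² when D ≤ ε² / 4.  Since 1 / (1 + h) ≤ 1 - h + 2h² for |h| ≤ 1/2, its
-- inverse has mean at most ρ when D > ε².  The test multiplies the factors of independent
-- rounds until ρᵏ < δ and accepts if the product is at most 1; by Markov's inequality, applied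
-- to the product or to its inverse, it errs with probability at most δ.  Since
-- exp (k η) ≤ (1 - η)⁻ᵏ, O(log (1/δ) / μ²) rounds suffice.  If ε² ≥ 2 it accepts at once,
-- because D ≤ 2.

module Submission where

open import Defs
open import Level using (0ℓ)
open import Algebra.Bundles using (CommutativeRing)
open import Algebra.Solver.Ring.AlmostCommutativeRing
  using (fromCommutativeRing; _-Raw-AlmostCommutative⟶_)
import Algebra.Properties.CommutativeMonoid.Sum as MonoidSum
import Algebra.Properties.Monoid.Mult as MonoidMult
import Algebra.Properties.Ring as RingProperties
import Algebra.Properties.Semiring.Mult as SemiringMult
import Algebra.Properties.Semiring.Sum as SemiringSum
import Algebra.Solver.Ring as RingSolver
open import Data.Bool.Base using (Bool; true; false; T; if_then_else_)
open import Data.Empty using (⊥-elim)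
open import Data.Fin.Base as Fin using (Fin; toℕ)
open import Data.Integer.Base as ℤ using (ℤ; +_; -[1+_]; _⊖_; _◃_)
import Data.Integer.Properties as ℤ
open import Data.List.Base as List using (List; []; _∷_; [_]; _++_; length)
open import Data.List.Relation.Unary.All using (All; []; _∷_)
import Data.List.Relation.Unary.All.Properties as All
import Data.Maybe.Base as Maybe
open import Data.Nat.Base as ℕ using (ℕ; zero; suc; _∸_; _!)
open import Data.Nat.Properties using (0∸n≡0)
open import Data.Product.Base using (∃-syntax; _×_; _,_; proj₁; proj₂)
import Data.Sign.Base as Sign
open import Data.Sum.Base using (inj₁; inj₂)
open import Data.Unit.Base using (⊤)
open import Data.Vec.Functional using (Vector)
open import Function.Base using (_∘_)
open import Relation.Binary.Bundles using (Poset)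
open import Relation.Binary.PropositionalEquality.Core as ≡ using (_≡_)
import Relation.Binary.Reasoning.PartialOrder as PartialOrderReasoning
import Relation.Binary.Reasoning.Setoid as SetoidReasoning
open import Relation.Binary.Structures using (IsDecTotalOrder)
open import Relation.Nullary.Decidable using (yes; no; dec⇒maybe; dec-true; dec-false)
open import Relation.Nullary.Negation.Core using (¬_)

module IntegerSolver (R : CommutativeRing 0ℓ 0ℓ) where
  open CommutativeRing R
  open RingProperties ring
    using (-0#≈0#; -‿+-comm; -‿involutive; -‿distribˡ-*; -‿distribʳ-*)
  open MonoidMult +-monoid using (×-homo-+) renaming (_×_ to _·_)
  open SemiringMult semiring using (×1-homo-*)
  open SetoidReasoning setoid

  fromℤ : ℤ → Carrier
  fromℤ (+ n)    = n · 1#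
  fromℤ -[1+ n ] = - (suc n · 1#)

  cancel-common : ∀ a x y → (a + x) - (a + y) ≈ x - y
  cancel-common a x y = begin
    (a + x) - (a + y)       ≈⟨ +-congˡ (-‿+-comm a y) ⟨
    (a + x) + (- a + - y)   ≈⟨ +-congʳ (+-comm a x) ⟩
    (x + a) + (- a + - y)   ≈⟨ +-assoc x a _ ⟩
    x + (a + (- a + - y))   ≈⟨ +-congˡ (+-assoc a (- a) (- y)) ⟨
    x + ((a + - a) + - y)   ≈⟨ +-congˡ (+-congʳ (-‿inverseʳ a)) ⟩
    x + (0# + - y)          ≈⟨ +-congˡ (+-identityˡ (- y)) ⟩
    x - y                   ∎

  fromℤ-⊖ : ∀ m n → fromℤ (m ⊖ n) ≈ m · 1# - n · 1#
  fromℤ-⊖ m       zero    = sym (trans (+-congˡ -0#≈0#) (+-identityʳ _))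
  fromℤ-⊖ zero    (suc n) = sym (+-identityˡ _)
  fromℤ-⊖ (suc m) (suc n) = begin
    fromℤ (suc m ⊖ suc n)            ≡⟨ ≡.cong fromℤ (ℤ.[1+m]⊖[1+n]≡m⊖n m n) ⟩
    fromℤ (m ⊖ n)                    ≈⟨ fromℤ-⊖ m n ⟩
    m · 1# - n · 1#                  ≈⟨ cancel-common 1# _ _ ⟨
    suc m · 1# - suc n · 1#          ∎

  fromℤ-+ : ∀ i j → fromℤ (i ℤ.+ j) ≈ fromℤ i + fromℤ j
  fromℤ-+ (+ m)    (+ n)    = ×-homo-+ 1# m n
  fromℤ-+ (+ m)    -[1+ n ] = fromℤ-⊖ m (suc n)
  fromℤ-+ -[1+ m ] (+ n)    = trans (fromℤ-⊖ n (suc m)) (+-comm _ _)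
  fromℤ-+ -[1+ m ] -[1+ n ] = begin
    - (1# + (1# + (m ℕ.+ n) · 1#))    ≈⟨ -‿cong (+-assoc 1# 1# _) ⟨
    - ((1# + 1#) + (m ℕ.+ n) · 1#)    ≈⟨ -‿cong (+-congˡ (×-homo-+ 1# m n)) ⟩
    - ((1# + 1#) + (m · 1# + n · 1#)) ≈⟨ -‿cong (+-assoc 1# 1# _) ⟩
    - (1# + (1# + (m · 1# + n · 1#))) ≈⟨ -‿cong (+-congˡ (+-assoc 1# _ _)) ⟨
    - (1# + (suc m · 1# + n · 1#))    ≈⟨ -‿cong (+-congˡ (+-comm _ _)) ⟩
    - (1# + (n · 1# + suc m · 1#))    ≈⟨ -‿cong (+-assoc 1# _ _) ⟨
    - (suc n · 1# + suc m · 1#)       ≈⟨ -‿cong (+-comm _ _) ⟩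
    - (suc m · 1# + suc n · 1#)       ≈⟨ -‿+-comm _ _ ⟨
    - (suc m · 1#) + - (suc n · 1#)   ∎

  fromℤ-neg◃ : ∀ n → fromℤ (Sign.- ◃ n) ≈ - (n · 1#)
  fromℤ-neg◃ zero    = sym -0#≈0#
  fromℤ-neg◃ (suc n) = refl

  fromℤ-pos◃ : ∀ n → fromℤ (Sign.+ ◃ n) ≈ n · 1#
  fromℤ-pos◃ zero    = refl
  fromℤ-pos◃ (suc n) = refl

  fromℤ-* : ∀ i j → fromℤ (i ℤ.* j) ≈ fromℤ i * fromℤ j
  fromℤ-* (+ m)    (+ n)    = trans (fromℤ-pos◃ (m ℕ.* n)) (×1-homo-* m n)
  fromℤ-* (+ m)    -[1+ n ] = begin
    fromℤ (Sign.- ◃ m ℕ.* suc n)  ≈⟨ fromℤ-neg◃ (m ℕ.* suc n) ⟩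
    - ((m ℕ.* suc n) · 1#)        ≈⟨ -‿cong (×1-homo-* m (suc n)) ⟩
    - (m · 1# * suc n · 1#)       ≈⟨ -‿distribʳ-* _ _ ⟩
    m · 1# * - (suc n · 1#)       ∎
  fromℤ-* -[1+ m ] (+ n)    = begin
    fromℤ (Sign.- ◃ suc m ℕ.* n)  ≈⟨ fromℤ-neg◃ (suc m ℕ.* n) ⟩
    - ((suc m ℕ.* n) · 1#)        ≈⟨ -‿cong (×1-homo-* (suc m) n) ⟩
    - (suc m · 1# * n · 1#)       ≈⟨ -‿distribˡ-* _ _ ⟩
    - (suc m · 1#) * n · 1#       ∎
  fromℤ-* -[1+ m ] -[1+ n ] = begin
    (suc m ℕ.* suc n) · 1#            ≈⟨ ×1-homo-* (suc m) (suc n) ⟩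
    suc m · 1# * suc n · 1#           ≈⟨ -‿involutive _ ⟨
    - - (suc m · 1# * suc n · 1#)     ≈⟨ -‿cong (-‿distribʳ-* _ _) ⟩
    - (suc m · 1# * - (suc n · 1#))   ≈⟨ -‿distribˡ-* _ _ ⟩
    - (suc m · 1#) * - (suc n · 1#)   ∎

  fromℤ-neg : ∀ i → fromℤ (ℤ.- i) ≈ - fromℤ i
  fromℤ-neg (+ zero)  = sym -0#≈0#
  fromℤ-neg (+ suc n) = refl
  fromℤ-neg -[1+ n ]  = sym (-‿involutive _)

  -- Separating 1 makes `con (+ 1)` denote 1# instead of 1# + 0#.
  coefficient : ℤ → Carrier
  coefficient (+ 1) = 1#
  coefficient i     = fromℤ i

  coefficient≈fromℤ : ∀ i → coefficient i ≈ fromℤ i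
  coefficient≈fromℤ (+ 0)           = refl
  coefficient≈fromℤ (+ 1)           = sym (+-identityʳ 1#)
  coefficient≈fromℤ (+ suc (suc n)) = refl
  coefficient≈fromℤ -[1+ n ]        = refl

  morphism :
    CommutativeRing.rawRing ℤ.+-*-commutativeRing
      -Raw-AlmostCommutative⟶ fromCommutativeRing R
  morphism = record
    { ⟦_⟧    = coefficient
    ; +-homo = λ i j → trans (coefficient≈fromℤ (i ℤ.+ j)) (trans (fromℤ-+ i j)
                 (sym (+-cong (coefficient≈fromℤ i) (coefficient≈fromℤ j))))
    ; *-homo = λ i j → trans (coefficient≈fromℤ (i ℤ.* j)) (trans (fromℤ-* i j)
                 (sym (*-cong (coefficient≈fromℤ i) (coefficient≈fromℤ j))))
    ; -‿homo = λ i → trans (coefficient≈fromℤ (ℤ.- i)) (trans (fromℤ-neg i)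
                 (sym (-‿cong (coefficient≈fromℤ i))))
    ; 0-homo = refl
    ; 1-homo = refl
    }

  open RingSolver _ _ morphism
    (λ i j → Maybe.map (λ i≡j → reflexive (≡.cong coefficient i≡j)) (dec⇒maybe (i ℤ.≟ j)))
    public using (solve; con; _:=_; _:+_; _:*_; _:-_; :-_)

module OrderedField (ℝ : Reals) where
  open Reals ℝ
  open CommutativeRing commutativeRing public
    using (+-cong; +-congˡ; +-congʳ; *-cong; *-congˡ; *-congʳ; -‿cong;
           +-comm; +-identityˡ; +-identityʳ; *-comm; *-assoc; *-identityˡ; *-identityʳ;
           zeroˡ; zeroʳ; -‿inverseʳ; +-monoid; +-commutativeMonoid)
    renaming (refl to ≈-refl; sym to ≈-sym; trans to ≈-trans; reflexive to ≈-reflexive)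
  open IsDecTotalOrder isDecTotalOrder public
    using (isPartialOrder)
    renaming (refl to ≤-refl; trans to ≤-trans; reflexive to ≤-reflexive;
              antisym to ≤-antisym; total to ≤-total)
  open IntegerSolver commutativeRing public

  poset : Poset _ _ _
  poset = record { isPartialOrder = isPartialOrder }

  module ≤-Reasoning = PartialOrderReasoning poset
  open ≤-Reasoning

  <⇒≤ : ∀ {x y} → x < y → x ≤ y
  <⇒≤ {x} {y} x<y with ≤-total x y
  ... | inj₁ x≤y = x≤y
  ... | inj₂ y≤x = ⊥-elim (x<y y≤x)

  <-≤-trans : ∀ {x y z} → x < y → y ≤ z → x < z
  <-≤-trans x<y y≤z z≤x = x<y (≤-trans y≤z z≤x)

  ≤-<-trans : ∀ {x y z} → x ≤ y → y < z → x < z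
  ≤-<-trans x≤y y<z z≤x = y<z (≤-trans z≤x x≤y)

  >⇒≉ : ∀ {x} → 0# < x → ¬ (x ≈ 0#)
  >⇒≉ 0<x x≈0 = 0<x (≤-reflexive x≈0)

  +-mono-≤ : ∀ {w x y z} → w ≤ x → y ≤ z → w + y ≤ x + z
  +-mono-≤ {w} {x} {y} {z} w≤x y≤z = begin
    w + y  ≤⟨ +-monoʳ-≤ w y≤z ⟩
    w + z  ≈⟨ +-comm w z ⟩
    z + w  ≤⟨ +-monoʳ-≤ z w≤x ⟩
    z + x  ≈⟨ +-comm z x ⟩
    x + z  ∎

  +-nonNegative : ∀ {x y} → 0# ≤ x → 0# ≤ y → 0# ≤ x + y
  +-nonNegative 0≤x 0≤y = ≤-trans (≤-reflexive (≈-sym (+-identityʳ 0#))) (+-mono-≤ 0≤x 0≤y)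

  ≤-by : ∀ {x y} e → 0# ≤ e → y ≈ x + e → x ≤ y
  ≤-by {x} {y} e 0≤e y≈x+e = begin
    x       ≈⟨ +-identityʳ x ⟨
    x + 0#  ≤⟨ +-monoʳ-≤ x 0≤e ⟩
    x + e   ≈⟨ y≈x+e ⟨
    y       ∎

  y≤z⇒0≤z-y : ∀ {y z} → y ≤ z → 0# ≤ z - y
  y≤z⇒0≤z-y {y} {z} y≤z = begin
    0#       ≈⟨ -‿inverseʳ y ⟨
    y - y    ≈⟨ +-comm y (- y) ⟩
    - y + y  ≤⟨ +-monoʳ-≤ (- y) y≤z ⟩
    - y + z  ≈⟨ +-comm (- y) z ⟩
    z - y    ∎

  *-monoʳ-≤ : ∀ {x y z} → 0# ≤ x → y ≤ z → x * y ≤ x * z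
  *-monoʳ-≤ {x} {y} {z} 0≤x y≤z =
    ≤-by _ (*-nonNegative 0≤x (y≤z⇒0≤z-y y≤z))
      (solve 3 (λ x y z → x :* z := x :* y :+ x :* (z :- y)) ≈-refl x y z)

  *-monoˡ-≤ : ∀ {x y z} → 0# ≤ x → y ≤ z → y * x ≤ z * x
  *-monoˡ-≤ {x} {y} {z} 0≤x y≤z = begin
    y * x  ≈⟨ *-comm y x ⟩
    x * y  ≤⟨ *-monoʳ-≤ 0≤x y≤z ⟩
    x * z  ≈⟨ *-comm x z ⟩
    z * x  ∎

  *-mono-≤ : ∀ {w x y z} → 0# ≤ w → 0# ≤ z → w ≤ x → y ≤ z → w * y ≤ x * z
  *-mono-≤ 0≤w 0≤z w≤x y≤z = ≤-trans (*-monoʳ-≤ 0≤w y≤z) (*-monoˡ-≤ 0≤z w≤x)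

  square-nonNegative : ∀ x → 0# ≤ x * x
  square-nonNegative x with ≤-total 0# x
  ... | inj₁ 0≤x = *-nonNegative 0≤x 0≤x
  ... | inj₂ x≤0 = begin
    0#                     ≤⟨ *-nonNegative (y≤z⇒0≤z-y x≤0) (y≤z⇒0≤z-y x≤0) ⟩
    (0# - x) * (0# - x)    ≈⟨ *-cong (+-identityˡ _) (+-identityˡ _) ⟩
    (- x) * (- x)          ≈⟨ solve 1 (λ x → :- x :* :- x := x :* x) ≈-refl x ⟩
    x * x                  ∎

  0≤1 : 0# ≤ 1#
  0≤1 = ≤-trans (square-nonNegative 1#) (≤-reflexive (*-identityˡ 1#))

  0<1 : 0# < 1#
  0<1 1≤0 = 0≉1 (≤-antisym 0≤1 1≤0)

  fromℕ-nonNegative : ∀ k → 0# ≤ fromℕ k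
  fromℕ-nonNegative zero    = ≤-refl
  fromℕ-nonNegative (suc k) = +-nonNegative 0≤1 (fromℕ-nonNegative k)

  fromℕ-positive : ∀ k → 0# < fromℕ (suc k)
  fromℕ-positive k = <-≤-trans 0<1 (≤-by _ (fromℕ-nonNegative k) ≈-refl)

  fromℕ-+ : ∀ m n → fromℕ (m ℕ.+ n) ≈ fromℕ m + fromℕ n
  fromℕ-+ = MonoidMult.×-homo-+ +-monoid 1#

  fromℕ-* : ∀ m n → fromℕ (m ℕ.* n) ≈ fromℕ m * fromℕ n
  fromℕ-* = SemiringMult.×1-homo-* semiring

  fromℕ-1 : fromℕ 1 ≈ 1#
  fromℕ-1 = +-identityʳ 1#

  ⁻¹-inverseˡ : ∀ {x} → 0# < x → x ⁻¹ * x ≈ 1#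
  ⁻¹-inverseˡ 0<x = ≈-trans (*-comm _ _) (⁻¹-inverse (>⇒≉ 0<x))

  ⁻¹-positive : ∀ {x} → 0# < x → 0# < x ⁻¹
  ⁻¹-positive {x} 0<x x⁻¹≤0 = 0<1 (begin
    1#        ≈⟨ ⁻¹-inverse (>⇒≉ 0<x) ⟨
    x * x ⁻¹  ≤⟨ *-monoʳ-≤ (<⇒≤ 0<x) x⁻¹≤0 ⟩
    x * 0#    ≈⟨ zeroʳ x ⟩
    0#        ∎)

  *-cancelˡ-≤ : ∀ {x y z} → 0# < x → x * y ≤ x * z → y ≤ z
  *-cancelˡ-≤ {x} {y} {z} 0<x xy≤xz = begin
    y               ≈⟨ *-identityˡ y ⟨
    1# * y          ≈⟨ *-congʳ (⁻¹-inverseˡ 0<x) ⟨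
    x ⁻¹ * x * y    ≈⟨ *-assoc _ _ _ ⟩
    x ⁻¹ * (x * y)  ≤⟨ *-monoʳ-≤ (<⇒≤ (⁻¹-positive 0<x)) xy≤xz ⟩
    x ⁻¹ * (x * z)  ≈⟨ *-assoc _ _ _ ⟨
    x ⁻¹ * x * z    ≈⟨ *-congʳ (⁻¹-inverseˡ 0<x) ⟩
    1# * z          ≈⟨ *-identityˡ z ⟩
    z               ∎

  *-positive : ∀ {x y} → 0# < x → 0# < y → 0# < x * y
  *-positive {x} {y} 0<x 0<y xy≤0 =
    0<y (*-cancelˡ-≤ 0<x (≤-trans xy≤0 (≤-reflexive (≈-sym (zeroʳ x)))))

  /-cancel : ∀ {x y} → 0# < y → x / y * y ≈ x
  /-cancel {x} {y} 0<y = begin-equality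
    x * y ⁻¹ * y    ≈⟨ *-assoc _ _ _ ⟩
    x * (y ⁻¹ * y)  ≈⟨ *-congˡ (⁻¹-inverseˡ 0<y) ⟩
    x * 1#          ≈⟨ *-identityʳ x ⟩
    x               ∎

  /-nonNegative : ∀ {x y} → 0# ≤ x → 0# < y → 0# ≤ x / y
  /-nonNegative 0≤x 0<y = *-nonNegative 0≤x (<⇒≤ (⁻¹-positive 0<y))

  ≤-/ : ∀ {x y z} → 0# < z → x * z ≤ y → x ≤ y / z
  ≤-/ {x} {y} {z} 0<z xz≤y = *-cancelˡ-≤ 0<z (begin
    z * x        ≈⟨ *-comm z x ⟩
    x * z        ≤⟨ xz≤y ⟩
    y            ≈⟨ /-cancel 0<z ⟨
    y / z * z    ≈⟨ *-comm _ z ⟩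
    z * (y / z)  ∎)

  *-cancelˡ-≈ : ∀ {x y z} → 0# < x → x * y ≈ x * z → y ≈ z
  *-cancelˡ-≈ 0<x xy≈xz = ≤-antisym
    (*-cancelˡ-≤ 0<x (≤-reflexive xy≈xz)) (*-cancelˡ-≤ 0<x (≤-reflexive (≈-sym xy≈xz)))

  square-cancel-≤ : ∀ {x y} → 0# ≤ y → x * x ≤ y * y → x ≤ y
  square-cancel-≤ {x} {y} 0≤y xx≤yy with x ≤? y
  ... | yes x≤y = x≤y
  ... | no  y<x = ⊥-elim (*-positive (≤-<-trans 0≤y y<x) 0<x-y (begin
    x * (x - y)                ≤⟨ ≤-by _ (*-nonNegative 0≤y (y≤z⇒0≤z-y (<⇒≤ y<x))) ≈-refl ⟩
    x * (x - y) + y * (x - y)  ≈⟨ solve 2 (λ x y → x :* (x :- y) :+ y :* (x :- y) :=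
                                    x :* x :- y :* y) ≈-refl x y ⟩
    x * x - y * y              ≤⟨ +-mono-≤ xx≤yy ≤-refl ⟩
    y * y - y * y              ≈⟨ -‿inverseʳ _ ⟩
    0#                         ∎))
    where
    0<x-y : 0# < x - y
    0<x-y x-y≤0 = y<x (≤-by _ (y≤z⇒0≤z-y x-y≤0)
      (solve 2 (λ x y → y := x :+ (con (+ 0) :- (x :- y))) ≈-refl x y))

  sup-least : ∀ P → (∃[ x ] P x) → ∀ {b} → UpperBound P b → sup P ≤ b
  sup-least P inhabited {b} bound with sup P ≤? b
  ... | yes sup≤b = sup≤b
  ... | no  b<sup with sup-approx P inhabited (b , bound) b b<sup
  ...   | x , Px , b<x = ⊥-elim (b<x (bound x Px))

  floor : ∀ {x} → 0# ≤ x → ∃[ k ] (fromℕ k ≤ x) × (x < fromℕ (suc k))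
  floor {x} 0≤x = above-all (sup-approx P inhabited bounded (sup P - 1#) sup-1<sup)
    where
    P : Carrier → Set
    P y = ∃[ k ] (y ≈ fromℕ k) × (fromℕ k ≤ x)
    inhabited : ∃[ y ] P y
    inhabited = 0# , 0 , ≈-refl , 0≤x
    bounded : ∃[ b ] UpperBound P b
    bounded = x , λ { y (k , y≈k , k≤x) → ≤-trans (≤-reflexive y≈k) k≤x }
    sup-1<sup : sup P - 1# < sup P
    sup-1<sup s≤s-1 = 0<1 (begin
      1#                         ≈⟨ solve 1 (λ s → con (+ 1) := con (+ 1) :- s :+ s) ≈-refl (sup P) ⟩
      1# - sup P + sup P         ≤⟨ +-monoʳ-≤ (1# - sup P) s≤s-1 ⟩
      1# - sup P + (sup P - 1#)  ≈⟨ solve 1 (λ s → con (+ 1) :- s :+ (s :- con (+ 1)) :=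
                                      con (+ 0)) ≈-refl (sup P) ⟩
      0#                         ∎)
    above-all : ∃[ y ] (P y × ¬ (y ≤ sup P - 1#)) → ∃[ k ] (fromℕ k ≤ x) × (x < fromℕ (suc k))
    above-all (y , (k , y≈k , k≤x) , sup-1<y) = k , k≤x , λ k+1≤x → sup-1<y (begin
      y                   ≈⟨ y≈k ⟩
      fromℕ k             ≈⟨ solve 1 (λ y → y := con (+ 1) :+ y :- con (+ 1)) ≈-refl (fromℕ k) ⟩
      fromℕ (suc k) - 1#  ≤⟨ +-mono-≤ (sup-upper P inhabited bounded _ (suc k , ≈-refl , k+1≤x)) ≤-refl ⟩
      sup P - 1#          ∎)

module Sums (ℝ : Reals) where
  open Reals ℝ
  open OrderedField ℝ
  open ≤-Reasoning
  open MonoidSum +-commutativeMonoid public using (sum-cong-≋; ∑-distrib-+)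
  open SemiringSum semiring public using (*-distribˡ-sum)

  sum-mono : ∀ {n} {f g : Vector Carrier n} → (∀ i → f i ≤ g i) → sum f ≤ sum g
  sum-mono {zero}  f≤g = ≤-refl
  sum-mono {suc n} f≤g = +-mono-≤ (f≤g Fin.zero) (sum-mono (f≤g ∘ Fin.suc))

  sum-zero : ∀ {n} {f : Vector Carrier n} → (∀ i → f i ≈ 0#) → sum f ≈ 0#
  sum-zero {zero}  f≈0 = ≈-refl
  sum-zero {suc n} f≈0 = ≈-trans (+-cong (f≈0 Fin.zero) (sum-zero (f≈0 ∘ Fin.suc))) (+-identityˡ 0#)

  sum-extend : ∀ (f : ℕ → Carrier) → (∀ k → 0# ≤ f k) → ∀ n →
               sum {n} (f ∘ toℕ) ≤ sum {suc n} (f ∘ toℕ)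
  sum-extend f 0≤f zero    = +-nonNegative (0≤f 0) ≤-refl
  sum-extend f 0≤f (suc n) = +-monoʳ-≤ (f 0) (sum-extend (f ∘ suc) (0≤f ∘ suc) n)

module ExpLog (ℝ : Reals) where
  open Reals ℝ
  open OrderedField ℝ
  open Sums ℝ
  open ≤-Reasoning

  ^-nonNegative : ∀ {x} k → 0# ≤ x → 0# ≤ x ^ k
  ^-nonNegative zero    0≤x = 0≤1
  ^-nonNegative (suc k) 0≤x = *-nonNegative 0≤x (^-nonNegative k 0≤x)

  ^-positive : ∀ {x} k → 0# < x → 0# < x ^ k
  ^-positive zero    0<x = 0<1
  ^-positive (suc k) 0<x = *-positive 0<x (^-positive k 0<x)

  ^-mono-≤ : ∀ {x y} k → 0# ≤ x → x ≤ y → x ^ k ≤ y ^ k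
  ^-mono-≤ zero    0≤x x≤y = ≤-refl
  ^-mono-≤ (suc k) 0≤x x≤y =
    *-mono-≤ 0≤x (^-nonNegative k (≤-trans 0≤x x≤y)) x≤y (^-mono-≤ k 0≤x x≤y)

  factorial-positive : ∀ k → 0# < fromℕ (k !)
  factorial-positive zero    = fromℕ-positive 0
  factorial-positive (suc k) = <-≤-trans
    (*-positive (fromℕ-positive k) (factorial-positive k))
    (≤-reflexive (≈-sym (fromℕ-* (suc k) (k !))))

  term : Carrier → ℕ → Carrier
  term x k = x ^ k / fromℕ (k !)

  term-nonNegative : ∀ {x} → 0# ≤ x → ∀ k → 0# ≤ term x k
  term-nonNegative 0≤x k = /-nonNegative (^-nonNegative k 0≤x) (factorial-positive k)

  expSum-nonNegative : ∀ {x} M → 0# ≤ x → 0# ≤ expSum x M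
  expSum-nonNegative zero    0≤x = ≤-refl
  expSum-nonNegative (suc M) 0≤x = ≤-trans (expSum-nonNegative M 0≤x)
    (sum-extend (term _) (term-nonNegative 0≤x) M)

  expSum-mono : ∀ {x y} M → 0# ≤ x → x ≤ y → expSum x M ≤ expSum y M
  expSum-mono M 0≤x x≤y = sum-mono {M} (λ k →
    *-monoˡ-≤ (<⇒≤ (⁻¹-positive (factorial-positive (toℕ k)))) (^-mono-≤ (toℕ k) 0≤x x≤y))

  expSum-0 : ∀ M → expSum 0# M ≤ 1#
  expSum-0 zero    = 0≤1
  expSum-0 (suc M) = begin
    1# / fromℕ 1 + sum {M} (λ k → term 0# (suc (toℕ k)))
      ≈⟨ +-cong (≈-trans (≈-sym (≈-trans (*-congˡ fromℕ-1) (*-identityʳ _)))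
                         (/-cancel (fromℕ-positive 0)))
           (sum-zero {M} (λ k → ≈-trans (*-congʳ (zeroˡ (0# ^ toℕ k))) (zeroˡ _))) ⟩
    1# + 0#  ≈⟨ +-identityʳ 1# ⟩
    1#       ∎

  -- The mean value inequality for z ↦ z ^ suc k between x and x + η.
  ^-increment : ∀ {x η} k → 0# ≤ x → 0# ≤ η →
                (x + η) ^ suc k ≤ x ^ suc k + η * (fromℕ (suc k) * (x + η) ^ k)
  ^-increment {x} {η} zero    0≤x 0≤η = ≤-reflexive
    (solve 2 (λ x η → (x :+ η) :* con (+ 1) := x :* con (+ 1) :+ η :* ((con (+ 1) :+ con (+ 0)) :* con (+ 1)))
      ≈-refl x η)
  ^-increment {x} {η} (suc k) 0≤x 0≤η = begin
    z * z ^ suc k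
      ≤⟨ *-monoʳ-≤ 0≤z (^-increment k 0≤x 0≤η) ⟩
    z * (x ^ suc k + η * (fromℕ (suc k) * z ^ k))
      ≈⟨ solve 5 (λ x η p m w → (x :+ η) :* (p :+ η :* (m :* w)) :=
           (x :* p :+ η :* (m :* ((x :+ η) :* w))) :+ η :* p) ≈-refl x η _ _ _ ⟩
    (x * x ^ suc k + η * (fromℕ (suc k) * z ^ suc k)) + η * x ^ suc k
      ≤⟨ +-monoʳ-≤ _ (*-monoʳ-≤ 0≤η (^-mono-≤ (suc k) 0≤x x≤z)) ⟩
    (x * x ^ suc k + η * (fromℕ (suc k) * z ^ suc k)) + η * z ^ suc k
      ≈⟨ solve 4 (λ a η m w → (a :+ η :* (m :* w)) :+ η :* w :=
           a :+ η :* ((con (+ 1) :+ m) :* w)) ≈-refl _ _ _ _ ⟩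
    x * x ^ suc k + η * (fromℕ (suc (suc k)) * z ^ suc k) ∎
    where
    z = x + η
    0≤z = +-nonNegative 0≤x 0≤η
    x≤z = ≤-by η 0≤η ≈-refl

  term-increment : ∀ {x η} k → 0# ≤ x → 0# ≤ η →
                   term (x + η) (suc k) ≤ term x (suc k) + η * term (x + η) k
  term-increment {x} {η} k 0≤x 0≤η = begin
    z ^ suc k * f ⁻¹
      ≤⟨ *-monoˡ-≤ (<⇒≤ (⁻¹-positive (factorial-positive (suc k)))) (^-increment k 0≤x 0≤η) ⟩
    (x ^ suc k + η * (fromℕ (suc k) * z ^ k)) * f ⁻¹
      ≈⟨ solve 5 (λ a η m w i → (a :+ η :* (m :* w)) :* i := a :* i :+ η :* (w :* (m :* i))) ≈-refl _ _ _ _ _ ⟩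
    x ^ suc k * f ⁻¹ + η * (z ^ k * (fromℕ (suc k) * f ⁻¹))
      ≈⟨ +-congˡ (*-congˡ (*-congˡ suc-k/f)) ⟩
    term x (suc k) + η * term z k ∎
    where
    z = x + η
    f = fromℕ (suc k !)
    suc-k/f : fromℕ (suc k) * f ⁻¹ ≈ fromℕ (k !) ⁻¹
    suc-k/f = *-cancelˡ-≈ (factorial-positive k) (begin-equality
      fromℕ (k !) * (fromℕ (suc k) * f ⁻¹)
        ≈⟨ solve 3 (λ a b c → a :* (b :* c) := b :* a :* c) ≈-refl _ _ _ ⟩
      fromℕ (suc k) * fromℕ (k !) * f ⁻¹   ≈⟨ *-congʳ (fromℕ-* (suc k) (k !)) ⟨
      f * f ⁻¹                             ≈⟨ ⁻¹-inverse (>⇒≉ (factorial-positive (suc k))) ⟩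
      1#                                   ≈⟨ ⁻¹-inverse (>⇒≉ (factorial-positive k)) ⟨
      fromℕ (k !) * fromℕ (k !) ⁻¹         ∎)

  expSum-increment : ∀ {x η} M → 0# ≤ x → 0# ≤ η →
                     expSum (x + η) M ≤ expSum x M + η * expSum (x + η) M
  expSum-increment {x} {η} zero    0≤x 0≤η =
    ≤-reflexive (solve 1 (λ η → con (+ 0) := con (+ 0) :+ η :* con (+ 0)) ≈-refl η)
  expSum-increment {x} {η} (suc M) 0≤x 0≤η = begin
    term x 0 + sum {M} (λ k → term (x + η) (suc (toℕ k)))
      ≤⟨ +-monoʳ-≤ _ (sum-mono {M} (λ k → term-increment (toℕ k) 0≤x 0≤η)) ⟩
    term x 0 + sum {M} (λ k → term x (suc (toℕ k)) + η * term (x + η) (toℕ k))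
      ≈⟨ +-congˡ (∑-distrib-+ {M} _ _) ⟩
    term x 0 + (sum {M} (λ k → term x (suc (toℕ k))) + sum {M} (λ k → η * term (x + η) (toℕ k)))
      ≈⟨ solve 3 (λ a b c → a :+ (b :+ c) := a :+ b :+ c) ≈-refl _ _ _ ⟩
    expSum x (suc M) + sum {M} (λ k → η * term (x + η) (toℕ k))
      ≈⟨ +-congˡ (*-distribˡ-sum {M} η _) ⟨
    expSum x (suc M) + η * expSum (x + η) M
      ≤⟨ +-monoʳ-≤ _ (*-monoʳ-≤ 0≤η (sum-extend (term (x + η)) (term-nonNegative (+-nonNegative 0≤x 0≤η)) M)) ⟩
    expSum x (suc M) + η * expSum (x + η) (suc M) ∎

  -- Iterates expSum (x + η) M ≤ (1 - η)⁻¹ * expSum x M.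
  expSum-geometric : ∀ {η} → 0# ≤ η → 0# ≤ 1# - η → ∀ N M →
                     expSum (fromℕ N * η) M * (1# - η) ^ N ≤ 1#
  expSum-geometric {η} 0≤η 0≤1-η zero M = begin
    expSum (0# * η) M * 1#  ≈⟨ *-identityʳ _ ⟩
    expSum (0# * η) M       ≤⟨ expSum-mono M (≤-reflexive (≈-sym (zeroˡ η))) (≤-reflexive (zeroˡ η)) ⟩
    expSum 0# M             ≤⟨ expSum-0 M ⟩
    1#                      ∎
  expSum-geometric {η} 0≤η 0≤1-η (suc N) M = begin
    expSum ((1# + fromℕ N) * η) M * (ρ * ρ ^ N)
      ≤⟨ *-monoˡ-≤ (^-nonNegative (suc N) 0≤1-η)
           (expSum-mono M (*-nonNegative (fromℕ-nonNegative (suc N)) 0≤η)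
             (≤-reflexive (solve 2 (λ n η → (con (+ 1) :+ n) :* η := n :* η :+ η) ≈-refl (fromℕ N) η))) ⟩
    expSum (y + η) M * (ρ * ρ ^ N)
      ≤⟨ ≤-by ((expSum y M + η * expSum (y + η) M - expSum (y + η) M) * ρ ^ N)
           (*-nonNegative (y≤z⇒0≤z-y (expSum-increment M 0≤y 0≤η)) (^-nonNegative N 0≤1-η))
           (solve 4 (λ e e′ η r → e :* r :=
              e′ :* ((con (+ 1) :- η) :* r) :+ (e :+ η :* e′ :- e′) :* r)
              ≈-refl (expSum y M) (expSum (y + η) M) η (ρ ^ N)) ⟩
    expSum y M * ρ ^ N
      ≤⟨ expSum-geometric 0≤η 0≤1-η N M ⟩
    1# ∎
    where
    ρ = 1# - η
    y = fromℕ N * η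
    0≤y = *-nonNegative (fromℕ-nonNegative N) 0≤η

  IsExpSum : Carrier → Carrier → Set
  IsExpSum x s = ∃[ M ] s ≈ expSum x M

  expSum-bounded : ∀ {x} → 0# ≤ x → ∃[ b ] UpperBound (IsExpSum x) b
  expSum-bounded {x} 0≤x = 1# / h ^ suc N , bound
    where
    h = fromℕ 2 ⁻¹
    0≤2x = *-nonNegative (fromℕ-nonNegative 2) 0≤x
    0<h = ⁻¹-positive (fromℕ-positive 1)
    2h≈1 : fromℕ 2 * h ≈ 1#
    2h≈1 = ⁻¹-inverse (>⇒≉ (fromℕ-positive 1))
    1-h≈h : 1# - h ≈ h
    1-h≈h = ≈-trans (+-congʳ (≈-sym 2h≈1))
      (solve 1 (λ h → con (+ 2) :* h :- h := h) ≈-refl h)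
    N = proj₁ (floor 0≤2x)
    x≤Nh : x ≤ fromℕ (suc N) * h
    x≤Nh = begin
      x                  ≈⟨ *-identityˡ x ⟨
      1# * x             ≈⟨ *-congʳ 2h≈1 ⟨
      fromℕ 2 * h * x    ≈⟨ solve 3 (λ a h x → a :* h :* x := a :* x :* h) ≈-refl _ h x ⟩
      fromℕ 2 * x * h    ≤⟨ *-monoˡ-≤ (<⇒≤ 0<h) (<⇒≤ (proj₂ (proj₂ (floor 0≤2x)))) ⟩
      fromℕ (suc N) * h  ∎
    h≤1-h : h ≤ 1# - h
    h≤1-h = ≤-reflexive (≈-sym 1-h≈h)
    0≤1-h : 0# ≤ 1# - h
    0≤1-h = ≤-trans (<⇒≤ 0<h) h≤1-h
    bound : UpperBound (IsExpSum x) (1# / h ^ suc N)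
    bound s (M , s≈) = ≤-/ (^-positive (suc N) 0<h) (begin
      s * h ^ suc N
        ≈⟨ *-congʳ s≈ ⟩
      expSum x M * h ^ suc N
        ≤⟨ *-mono-≤ (expSum-nonNegative M 0≤x) (^-nonNegative (suc N) 0≤1-h)
             (expSum-mono M 0≤x x≤Nh) (^-mono-≤ (suc N) (<⇒≤ 0<h) h≤1-h) ⟩
      expSum (fromℕ (suc N) * h) M * (1# - h) ^ suc N
        ≤⟨ expSum-geometric (<⇒≤ 0<h) 0≤1-h (suc N) M ⟩
      1# ∎)

  exp-least : ∀ {x b} → (∀ M → expSum x M ≤ b) → exp x ≤ b
  exp-least {x} {b} bound = sup-least (IsExpSum x) (expSum x 0 , 0 , ≈-refl)
    (λ { s (M , s≈) → ≤-trans (≤-reflexive s≈) (bound M) })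

  x≤exp : ∀ {x} → 0# ≤ x → x ≤ exp x
  x≤exp {x} 0≤x = begin
    x           ≤⟨ ≤-/ (factorial-positive 1) (≤-reflexive (*-congˡ fromℕ-1)) ⟩
    term x 1    ≤⟨ ≤-by (term x 0) (term-nonNegative 0≤x 0)
                     (solve 2 (λ a b → a :+ (b :+ con (+ 0)) := b :+ a) ≈-refl _ _) ⟩
    expSum x 2  ≤⟨ sup-upper (IsExpSum x) (expSum x 0 , 0 , ≈-refl) (expSum-bounded 0≤x)
                     _ (2 , ≈-refl) ⟩
    exp x       ∎

  ≤-log : ∀ {x y} → 1# ≤ x → 0# ≤ y → exp y ≤ x → y ≤ log x
  ≤-log {x} {y} 1≤x 0≤y exp≤x = sup-upper _
    (0# , ≤-refl , ≤-trans (exp-least expSum-0) 1≤x)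
    (x , λ { z (0≤z , exp≤x) → ≤-trans (x≤exp 0≤z) exp≤x })
    y (0≤y , exp≤x)

  log-nonNegative : ∀ {x} → 1# ≤ x → 0# ≤ log x
  log-nonNegative 1≤x = ≤-log 1≤x ≤-refl (≤-trans (exp-least expSum-0) 1≤x)

  geometric-decay : ∀ {η δ} N → 0# ≤ η → 0# ≤ 1# - η → 0# < δ → δ ≤ 1# →
                    log (1# / δ) < fromℕ N * η → (1# - η) ^ N < δ
  geometric-decay {η} {δ} N 0≤η 0≤1-η 0<δ δ≤1 log<Nη δ≤ρᴺ =
    log<Nη (≤-log (≤-/ 0<δ (≤-trans (≤-reflexive (*-identityˡ δ)) δ≤1))
      0≤Nη
      (exp-least (λ M → ≤-/ 0<δ (≤-trans (*-monoʳ-≤ (expSum-nonNegative M 0≤Nη) δ≤ρᴺ)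
                                         (expSum-geometric 0≤η 0≤1-η N M)))))
    where
    0≤Nη = *-nonNegative (fromℕ-nonNegative N) 0≤η

module SquareRoot (ℝ : Reals) where
  open Reals ℝ
  open OrderedField ℝ
  open ≤-Reasoning

  √-inhabited : ∀ {x} → 0# ≤ x → ∃[ y ] y * y ≤ x
  √-inhabited 0≤x = 0# , ≤-trans (≤-reflexive (zeroˡ 0#)) 0≤x

  √-bounded : ∀ {x} → 0# ≤ x → ∃[ b ] UpperBound (λ y → y * y ≤ x) b
  √-bounded {x} 0≤x = 1# + x , λ y yy≤x → square-cancel-≤ (+-nonNegative 0≤1 0≤x) (begin
    y * y                ≤⟨ yy≤x ⟩
    x                    ≤⟨ ≤-by (1# + (x + x * x)) (+-nonNegative 0≤1 (+-nonNegative 0≤x (square-nonNegative x)))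
                              (solve 1 (λ x → (con (+ 1) :+ x) :* (con (+ 1) :+ x) :=
                                x :+ (con (+ 1) :+ (x :+ x :* x))) ≈-refl x) ⟩
    (1# + x) * (1# + x)  ∎)

  -- If b² < x, the harmonic mean of b and x / b lies strictly between b and √ x.
  √≤⇒≤square : ∀ {b x} → 0# < b → √ x ≤ b → x ≤ b * b
  √≤⇒≤square {b} {x} 0<b √x≤b with x ≤? b * b
  ... | yes x≤bb = x≤bb
  ... | no  bb<x = ⊥-elim (b<y (≤-trans (sup-upper _ (√-inhabited 0≤x) (√-bounded 0≤x) y yy≤x) √x≤b))
    where
    0≤x = ≤-trans (square-nonNegative b) (<⇒≤ bb<x)
    0<x = ≤-<-trans (square-nonNegative b) bb<x
    d = b * b + x
    0<d : 0# < d
    0<d = <-≤-trans 0<x (≤-by _ (square-nonNegative b) (+-comm _ _))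
    y = fromℕ 2 * b * x / d
    yd≈2bx : y * d ≈ fromℕ 2 * b * x
    yd≈2bx = /-cancel 0<d
    yy≤x : y * y ≤ x
    yy≤x = *-cancelˡ-≤ (*-positive 0<d 0<d) (begin
      d * d * (y * y)                            ≈⟨ solve 2 (λ d y → d :* d :* (y :* y) := y :* d :* (y :* d)) ≈-refl d y ⟩
      y * d * (y * d)                            ≈⟨ *-cong yd≈2bx yd≈2bx ⟩
      fromℕ 2 * b * x * (fromℕ 2 * b * x)        ≤⟨ ≤-by (x * ((b * b - x) * (b * b - x)))
                                                      (*-nonNegative 0≤x (square-nonNegative (b * b - x)))
                                                      (solve 2 (λ b x → (b :* b :+ x) :* (b :* b :+ x) :* x :=
                                                        con (+ 2) :* b :* x :* (con (+ 2) :* b :* x)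
                                                        :+ x :* ((b :* b :- x) :* (b :* b :- x))) ≈-refl b x) ⟩
      d * d * x                                  ∎)
    b<y : b < y
    b<y y≤b = bb<x (*-cancelˡ-≤ 0<b (≤-by (b * d - y * d) (y≤z⇒0≤z-y (*-monoˡ-≤ (<⇒≤ 0<d) y≤b)) (begin-equality
      b * (b * b)                          ≈⟨ solve 2 (λ b x → b :* (b :* b) :=
                                                b :* x :+ (b :* (b :* b :+ x) :- con (+ 2) :* b :* x)) ≈-refl b x ⟩
      b * x + (b * d - fromℕ 2 * b * x)    ≈⟨ +-congˡ (+-congˡ (-‿cong yd≈2bx)) ⟨
      b * x + (b * d - y * d)              ∎)))

  <√⇒square< : ∀ {b x} → 0# ≤ b → 0# ≤ x → b < √ x → b * b < x
  <√⇒square< 0≤b 0≤x b<√x x≤bb = b<√x (sup-least _ (√-inhabited 0≤x)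
    (λ y yy≤x → square-cancel-≤ 0≤b (≤-trans yy≤x x≤bb)))

-- 1 if a ≡ b and 0 otherwise.
same : ℕ → ℕ → ℕ
same a b = 1 ∸ ((a ∸ b) ℕ.+ (b ∸ a))

module Expectation (ℝ : Reals) where
  open Reals ℝ
  open OrderedField ℝ
  open Sums ℝ
  open Semantics ℝ
  open ≤-Reasoning

  collision : ∀ {n} → Fin n → Fin n → Carrier
  collision i j = fromℕ (same (toℕ i) (toℕ j))

  sum-collision : ∀ {n} (v : Vector Carrier n) i → sum (λ j → v j * collision i j) ≈ v i
  sum-collision {suc n} v Fin.zero = begin-equality
    v Fin.zero * fromℕ 1 + sum {n} (λ j → v (Fin.suc j) * fromℕ (0 ∸ toℕ j))
      ≈⟨ +-cong (≈-trans (*-congˡ fromℕ-1) (*-identityʳ _))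
           (sum-zero {n} (λ j → ≈-trans (*-congˡ (≈-reflexive (≡.cong fromℕ (0∸n≡0 (toℕ j))))) (zeroʳ _))) ⟩
    v Fin.zero + 0#  ≈⟨ +-identityʳ _ ⟩
    v Fin.zero       ∎
  sum-collision {suc n} v (Fin.suc i) = begin-equality
    v Fin.zero * fromℕ (0 ∸ (toℕ i ℕ.+ 0)) + sum (λ j → v (Fin.suc j) * collision i j)
      ≈⟨ +-cong (≈-trans (*-congˡ (≈-reflexive (≡.cong fromℕ (0∸n≡0 (toℕ i ℕ.+ 0))))) (zeroʳ _))
           (sum-collision (v ∘ Fin.suc) i) ⟩
    0# + v (Fin.suc i)  ≈⟨ +-identityˡ _ ⟩
    v (Fin.suc i)       ∎

  same≤1 : ∀ a b → fromℕ (same a b) ≤ 1#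
  same≤1 a b with (a ∸ b) ℕ.+ (b ∸ a)
  ... | zero  = ≤-reflexive fromℕ-1
  ... | suc k = ≤-trans (≤-reflexive (≈-reflexive (≡.cong fromℕ (0∸n≡0 k)))) 0≤1

  module _ {n : ℕ} where

    𝔼 : Distribution n → Vector Carrier n → Carrier
    𝔼 d f = sum (λ i → prob d i * f i)

    𝔼-cong : ∀ d {f g} → (∀ i → f i ≈ g i) → 𝔼 d f ≈ 𝔼 d g
    𝔼-cong d f≈g = sum-cong-≋ (λ i → *-congˡ (f≈g i))

    𝔼-mono : ∀ d {f g} → (∀ i → f i ≤ g i) → 𝔼 d f ≤ 𝔼 d g
    𝔼-mono d f≤g = sum-mono (λ i → *-monoʳ-≤ (nonNegative d i) (f≤g i))

    𝔼-affine : ∀ d a b f → 𝔼 d (λ i → a + b * f i) ≈ a + b * 𝔼 d f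
    𝔼-affine d a b f = begin-equality
      sum (λ i → prob d i * (a + b * f i))
        ≈⟨ sum-cong-≋ (λ i → solve 4 (λ p a b f → p :* (a :+ b :* f) := a :* p :+ b :* (p :* f))
             ≈-refl (prob d i) a b (f i)) ⟩
      sum (λ i → a * prob d i + b * (prob d i * f i))
        ≈⟨ ∑-distrib-+ {n} (λ i → a * prob d i) (λ i → b * (prob d i * f i)) ⟩
      sum (λ i → a * prob d i) + sum (λ i → b * (prob d i * f i))
        ≈⟨ +-cong (*-distribˡ-sum a (prob d)) (*-distribˡ-sum b (λ i → prob d i * f i)) ⟨
      a * sum (prob d) + b * 𝔼 d f
        ≈⟨ +-congʳ (≈-trans (*-congˡ (total d)) (*-identityʳ a)) ⟩
      a + b * 𝔼 d f ∎

    𝔼-+ : ∀ d f g → 𝔼 d (λ i → f i + g i) ≈ 𝔼 d f + 𝔼 d g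
    𝔼-+ d f g = begin-equality
      sum (λ i → prob d i * (f i + g i))
        ≈⟨ sum-cong-≋ (λ i → solve 3 (λ p f g → p :* (f :+ g) := p :* f :+ p :* g)
             ≈-refl (prob d i) (f i) (g i)) ⟩
      sum (λ i → prob d i * f i + prob d i * g i)
        ≈⟨ ∑-distrib-+ (λ i → prob d i * f i) (λ i → prob d i * g i) ⟩
      𝔼 d f + 𝔼 d g ∎

    𝔼-const : ∀ d a → 𝔼 d (λ _ → a) ≈ a
    𝔼-const d a = begin-equality
      𝔼 d (λ _ → a)            ≈⟨ 𝔼-cong d (λ _ → solve 1 (λ a → a := a :+ con (+ 0) :* con (+ 0)) ≈-refl a) ⟩
      𝔼 d (λ _ → a + 0# * 0#)  ≈⟨ 𝔼-affine d a 0# (λ _ → 0#) ⟩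
      a + 0# * 𝔼 d (λ _ → 0#)  ≈⟨ solve 2 (λ a x → a :+ con (+ 0) :* x := a) ≈-refl a _ ⟩
      a                        ∎

    prob≤1 : ∀ d i → prob d i ≤ 1#
    prob≤1 d i = begin
      prob d i                       ≈⟨ sum-collision (prob d) i ⟨
      𝔼 d (λ j → collision i j)      ≤⟨ 𝔼-mono d (λ j → same≤1 (toℕ i) (toℕ j)) ⟩
      𝔼 d (λ _ → 1#)                 ≈⟨ 𝔼-const d 1# ⟩
      1#                             ∎

    estimate : Fin n → Fin n → Fin n → Fin n → Carrier
    estimate i i′ j j′ =
      collision i i′ + collision j j′ - (collision i j + collision i j)

    module _ (p q : Distribution n) where

      distance² : Carrier
      distance² = sum (λ i → (prob p i - prob q i) ^ 2)

      distance²-nonNegative : 0# ≤ distance²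
      distance²-nonNegative = ≤-trans (≤-reflexive (≈-sym (sum-zero {n} (λ _ → ≈-refl))))
        (sum-mono {n} (λ i → ≤-trans (square-nonNegative (prob p i - prob q i))
          (≤-reflexive (*-congˡ (≈-sym (*-identityʳ _))))))

      distance²-expand :
        distance² ≈ 𝔼 p (prob p) + 𝔼 q (prob q) - (𝔼 p (prob q) + 𝔼 p (prob q))
      distance²-expand = begin-equality
        distance²
          ≈⟨ sum-cong-≋ (λ i → solve 2 (λ p q → (p :- q) :* ((p :- q) :* con (+ 1)) :=
               (p :* p :+ q :* q) :+ con (ℤ.- (+ 2)) :* (p :* q)) ≈-refl (prob p i) (prob q i)) ⟩
        sum (λ i → (prob p i * prob p i + prob q i * prob q i) + c * (prob p i * prob q i))
          ≈⟨ ∑-distrib-+ (λ i → prob p i * prob p i + prob q i * prob q i) (λ i → c * (prob p i * prob q i)) ⟩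
        sum (λ i → prob p i * prob p i + prob q i * prob q i) + sum (λ i → c * (prob p i * prob q i))
          ≈⟨ +-cong (∑-distrib-+ (λ i → prob p i * prob p i) (λ i → prob q i * prob q i))
                    (≈-sym (*-distribˡ-sum c (λ i → prob p i * prob q i))) ⟩
        𝔼 p (prob p) + 𝔼 q (prob q) + c * 𝔼 p (prob q)
          ≈⟨ solve 3 (λ a b r → a :+ b :+ con (ℤ.- (+ 2)) :* r := a :+ b :- (r :+ r)) ≈-refl _ _ _ ⟩
        𝔼 p (prob p) + 𝔼 q (prob q) - (𝔼 p (prob q) + 𝔼 p (prob q)) ∎
        where c = fromℤ (ℤ.- (+ 2))

      estimate-unbiased : ∀ a b →
        𝔼 p (λ i → 𝔼 p (λ i′ → 𝔼 q (λ j → 𝔼 q (λ j′ → a + b * estimate i i′ j j′))))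
          ≈ a + b * distance²
      estimate-unbiased a b = begin-equality
        𝔼 p (λ i → 𝔼 p (λ i′ → 𝔼 q (λ j → 𝔼 q (λ j′ → a + b * estimate i i′ j j′))))
          ≈⟨ 𝔼-cong p (λ i → 𝔼-cong p (λ i′ → 𝔼-cong q (λ j → average-j′ i i′ j))) ⟩
        𝔼 p (λ i → 𝔼 p (λ i′ → 𝔼 q (λ j →
          a + b * (collision i i′ - (collision i j + collision i j)) + b * prob q j)))
          ≈⟨ 𝔼-cong p (λ i → 𝔼-cong p (λ i′ → average-j i i′)) ⟩
        𝔼 p (λ i → 𝔼 p (λ i′ → a + b * (Q - (prob q i + prob q i)) + b * collision i i′))
          ≈⟨ 𝔼-cong p average-i′ ⟩
        𝔼 p (λ i → a + b * (Q + (prob p i - (prob q i + prob q i))))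
          ≈⟨ average-i ⟩
        a + b * distance² ∎
        where
        Q = 𝔼 q (prob q)
        average-j′ : ∀ i i′ j → 𝔼 q (λ j′ → a + b * estimate i i′ j j′) ≈
          a + b * (collision i i′ - (collision i j + collision i j)) + b * prob q j
        average-j′ i i′ j = begin-equality
          𝔼 q (λ j′ → a + b * estimate i i′ j j′)
            ≈⟨ 𝔼-cong q (λ j′ → solve 5 (λ a b x y z → a :+ b :* (x :+ y :- (z :+ z)) :=
                 a :+ b :* (x :- (z :+ z)) :+ b :* y)
                 ≈-refl a b (collision i i′) (collision j j′) (collision i j)) ⟩
          𝔼 q (λ j′ → a + b * (collision i i′ - (collision i j + collision i j)) + b * collision j j′)
            ≈⟨ 𝔼-affine q _ b (collision j) ⟩
          a + b * (collision i i′ - (collision i j + collision i j)) + b * 𝔼 q (collision j)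
            ≈⟨ +-congˡ (*-congˡ (sum-collision (prob q) j)) ⟩
          a + b * (collision i i′ - (collision i j + collision i j)) + b * prob q j ∎
        average-j : ∀ i i′ →
          𝔼 q (λ j → a + b * (collision i i′ - (collision i j + collision i j)) + b * prob q j) ≈
          a + b * (Q - (prob q i + prob q i)) + b * collision i i′
        average-j i i′ = begin-equality
          𝔼 q (λ j → a + b * (collision i i′ - (collision i j + collision i j)) + b * prob q j)
            ≈⟨ 𝔼-cong q (λ j → solve 5 (λ a b x y z → a :+ b :* (x :- (z :+ z)) :+ b :* y :=
                 (a :+ b :* x :+ b :* y) :+ (con (ℤ.- (+ 2)) :* b) :* z)
                 ≈-refl a b (collision i i′) (prob q j) (collision i j)) ⟩
          𝔼 q (λ j → (a + b * collision i i′ + b * prob q j) + (c * b) * collision i j)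
            ≈⟨ 𝔼-+ q (λ j → a + b * collision i i′ + b * prob q j) (λ j → (c * b) * collision i j) ⟩
          𝔼 q (λ j → a + b * collision i i′ + b * prob q j) + 𝔼 q (λ j → (c * b) * collision i j)
            ≈⟨ +-cong (𝔼-affine q _ b (prob q)) 
                 (≈-trans (𝔼-cong q (λ j → ≈-sym (+-identityˡ _))) (𝔼-affine q 0# (c * b) (collision i))) ⟩
          (a + b * collision i i′ + b * Q) + (0# + (c * b) * 𝔼 q (collision i))
            ≈⟨ +-congˡ (+-congˡ (*-congˡ (sum-collision (prob q) i))) ⟩
          (a + b * collision i i′ + b * Q) + (0# + (c * b) * prob q i)
            ≈⟨ solve 5 (λ a b x y z → (a :+ b :* x :+ b :* y) :+ (con (+ 0) :+ (con (ℤ.- (+ 2)) :* b) :* z) :=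
                 a :+ b :* (y :- (z :+ z)) :+ b :* x) ≈-refl a b (collision i i′) Q (prob q i) ⟩
          a + b * (Q - (prob q i + prob q i)) + b * collision i i′ ∎
          where c = fromℤ (ℤ.- (+ 2))
        average-i′ : ∀ i →
          𝔼 p (λ i′ → a + b * (Q - (prob q i + prob q i)) + b * collision i i′) ≈
          a + b * (Q + (prob p i - (prob q i + prob q i)))
        average-i′ i = begin-equality
          𝔼 p (λ i′ → a + b * (Q - (prob q i + prob q i)) + b * collision i i′)
            ≈⟨ 𝔼-affine p _ b (collision i) ⟩
          a + b * (Q - (prob q i + prob q i)) + b * 𝔼 p (collision i)
            ≈⟨ +-congˡ (*-congˡ (sum-collision (prob p) i)) ⟩
          a + b * (Q - (prob q i + prob q i)) + b * prob p i
            ≈⟨ solve 5 (λ a b x y z → a :+ b :* (x :- (z :+ z)) :+ b :* y :=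
                 a :+ b :* (x :+ (y :- (z :+ z)))) ≈-refl a b Q (prob p i) (prob q i) ⟩
          a + b * (Q + (prob p i - (prob q i + prob q i))) ∎
        average-i : 𝔼 p (λ i → a + b * (Q + (prob p i - (prob q i + prob q i)))) ≈ a + b * distance²
        average-i = begin-equality
          𝔼 p (λ i → a + b * (Q + (prob p i - (prob q i + prob q i))))
            ≈⟨ 𝔼-affine p a b (λ i → Q + (prob p i - (prob q i + prob q i))) ⟩
          a + b * 𝔼 p (λ i → Q + (prob p i - (prob q i + prob q i)))
            ≈⟨ +-congˡ (*-congˡ (begin-equality
              𝔼 p (λ i → Q + (prob p i - (prob q i + prob q i)))
                ≈⟨ 𝔼-cong p (λ i → solve 3 (λ q x y → q :+ (x :- (y :+ y)) :=
                     (q :+ con (ℤ.- (+ 2)) :* y) :+ x) ≈-refl Q (prob p i) (prob q i)) ⟩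
              𝔼 p (λ i → (Q + c * prob q i) + prob p i)
                ≈⟨ 𝔼-+ p (λ i → Q + c * prob q i) (prob p) ⟩
              𝔼 p (λ i → Q + c * prob q i) + 𝔼 p (prob p)
                ≈⟨ +-congʳ (𝔼-affine p Q c (prob q)) ⟩
              (Q + c * 𝔼 p (prob q)) + 𝔼 p (prob p)
                ≈⟨ solve 3 (λ q r p → (q :+ con (ℤ.- (+ 2)) :* r) :+ p := p :+ q :- (r :+ r)) ≈-refl Q _ _ ⟩
              𝔼 p (prob p) + Q - (𝔼 p (prob q) + 𝔼 p (prob q))
                ≈⟨ distance²-expand ⟨
              distance² ∎)) ⟩
          a + b * distance² ∎
          where c = fromℤ (ℤ.- (+ 2))

      distance²≤2 : distance² ≤ fromℕ 2
      distance²≤2 = begin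
        distance²
          ≈⟨ distance²-expand ⟩
        𝔼 p (prob p) + 𝔼 q (prob q) - (r + r)
          ≤⟨ ≤-by ((1# - 𝔼 p (prob p)) + (1# - 𝔼 q (prob q)) + (r + r))
               (+-nonNegative (+-nonNegative (self≤1 p) (self≤1 q)) (+-nonNegative 0≤r 0≤r))
               (solve 3 (λ a b r → con (+ 2) := a :+ b :- (r :+ r) :+
                 ((con (+ 1) :- a) :+ (con (+ 1) :- b) :+ (r :+ r))) ≈-refl _ _ _) ⟩
        fromℕ 2 ∎
        where
        r = 𝔼 p (prob q)
        0≤r : 0# ≤ r
        0≤r = ≤-trans (≤-reflexive (≈-sym (𝔼-const p 0#))) (𝔼-mono p (nonNegative q))
        self≤1 : ∀ d → 0# ≤ 1# - 𝔼 d (prob d)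
        self≤1 d = y≤z⇒0≤z-y (≤-trans (𝔼-mono d (prob≤1 d)) (≤-reflexive (𝔼-const d 1#)))

deterministic : Instr → Bool
deterministic (query _ _) = false
deterministic (flip _)    = false
deterministic _           = true

Deterministic : List Instr → Set
Deterministic []       = ⊤
Deterministic (i ∷ is) = T (deterministic i) × Deterministic is

module ProgramLogic (ℝ : Reals) where
  open Reals ℝ
  open OrderedField ℝ
  open Sums ℝ
  open Semantics ℝ
  open Expectation ℝ
  open ≤-Reasoning

  expectation-++ : {A : Set} (f : A → Carrier) (d e : Dist A) →
                   expectation f (d ++ e) ≈ expectation f d + expectation f e
  expectation-++ f []            e = ≈-sym (+-identityˡ _)
  expectation-++ f ((w , a) ∷ d) e = begin-equality
    w * f a + expectation f (d ++ e)              ≈⟨ +-congˡ (expectation-++ f d e) ⟩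
    w * f a + (expectation f d + expectation f e) ≈⟨ solve 3 (λ x y z → x :+ (y :+ z) :=
                                                      x :+ y :+ z) ≈-refl _ _ _ ⟩
    w * f a + expectation f d + expectation f e   ∎

  expectation-scale : {A : Set} (f : A → Carrier) (w : Carrier) (d : Dist A) →
                      expectation f (List.map (λ (v , a) → w * v , a) d) ≈ w * expectation f d
  expectation-scale f w []            = ≈-sym (zeroʳ w)
  expectation-scale f w ((v , a) ∷ d) = begin-equality
    w * v * f a + expectation f (List.map (λ (v , a) → w * v , a) d)
      ≈⟨ +-congˡ (expectation-scale f w d) ⟩
    w * v * f a + w * expectation f d
      ≈⟨ solve 4 (λ w v a e → w :* v :* a :+ w :* e := w :* (v :* a :+ e)) ≈-refl _ _ _ _ ⟩
    w * (v * f a + expectation f d) ∎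

  expectation->>= : {A B : Set} (f : B → Carrier) (d : Dist A) (k : A → Dist B) →
                    expectation f (d >>= k) ≈ expectation (λ a → expectation f (k a)) d
  expectation->>= f []            k = ≈-refl
  expectation->>= f ((w , a) ∷ d) k = begin-equality
    expectation f (List.map (λ (v , b) → w * v , b) (k a) ++ (d >>= k))
      ≈⟨ expectation-++ f (List.map (λ (v , b) → w * v , b) (k a)) (d >>= k) ⟩
    expectation f (List.map (λ (v , b) → w * v , b) (k a)) + expectation f (d >>= k)
      ≈⟨ +-cong (expectation-scale f w (k a)) (expectation->>= f d k) ⟩
    w * expectation f (k a) + expectation (λ a → expectation f (k a)) d ∎

  expectation-pure : {A : Set} (f : A → Carrier) (a : A) → expectation f (pure a) ≈ f a
  expectation-pure f a = ≈-trans (+-identityʳ _) (*-identityˡ _)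

  expectation-cong : {A : Set} {f g : A → Carrier} → (∀ a → f a ≈ g a) → (d : Dist A) →
                     expectation f d ≈ expectation g d
  expectation-cong f≈g []            = ≈-refl
  expectation-cong f≈g ((w , a) ∷ d) = +-cong (*-congˡ (f≈g a)) (expectation-cong f≈g d)

  expectation-tabulate : ∀ {A : Set} {n} (f : A → Carrier) (w : Vector Carrier n) (g : Fin n → A) →
                         expectation f (List.tabulate (λ i → w i , g i)) ≈ sum (λ i → w i * f (g i))
  expectation-tabulate {n = zero}  f w g = ≈-refl
  expectation-tabulate {n = suc n} f w g = +-congˡ (expectation-tabulate f (w ∘ Fin.suc) (g ∘ Fin.suc))

  support->>= : {A B : Set} {P : B → Set} (d : Dist A) (k : A → Dist B) →
                All (λ (_ , a) → All (λ (_ , b) → P b) (k a)) d → All (λ (_ , b) → P b) (d >>= k)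
  support->>= []            k []       = []
  support->>= ((w , a) ∷ d) k (h ∷ hs) = All.++⁺ (All.map⁺ h) (support->>= d k hs)

  effect : Instr → State → State
  effect (constₙ x k)  s = setNat s x k
  effect (addₙ x y z)  s = setNat s x (nat s y ℕ.+ nat s z)
  effect (subₙ x y z)  s = setNat s x (nat s y ∸ nat s z)
  effect (load x A y)  s = setNat s x (array s A (nat s y))
  effect (store A x y) s = record s { array = array s [ A ≔ array s A [ nat s x ≔ nat s y ] ] }
  effect (constᵣ x k)  s = setReal s x (fromℕ k)
  effect (addᵣ x y z)  s = setReal s x (real s y + real s z)
  effect (subᵣ x y z)  s = setReal s x (real s y - real s z)
  effect (mulᵣ x y z)  s = setReal s x (real s y * real s z)
  effect (divᵣ x y z)  s = setReal s x (real s y / real s z)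
  effect (castᵣ x y)   s = setReal s x (fromℕ (nat s y))
  effect (query _ _)   s = s
  effect (flip _)      s = s

  effects : List Instr → State → State
  effects []       s = s
  effects (i ∷ is) s = effects is (effect i s)

  module _ {n : ℕ} (p q : Distribution n) where
    open Run p q

    execute-deterministic : ∀ i s → T (deterministic i) → execute i s ≡ pure (effect i s)
    execute-deterministic (constₙ x k)  s _ = ≡.refl
    execute-deterministic (addₙ x y z)  s _ = ≡.refl
    execute-deterministic (subₙ x y z)  s _ = ≡.refl
    execute-deterministic (load x A y)  s _ = ≡.refl
    execute-deterministic (store A x y) s _ = ≡.refl
    execute-deterministic (constᵣ x k)  s _ = ≡.refl
    execute-deterministic (addᵣ x y z)  s _ = ≡.refl
    execute-deterministic (subᵣ x y z)  s _ = ≡.refl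
    execute-deterministic (mulᵣ x y z)  s _ = ≡.refl
    execute-deterministic (divᵣ x y z)  s _ = ≡.refl
    execute-deterministic (castᵣ x y)   s _ = ≡.refl

    -- For f = outputs v, the second field bounds by b the probability of missing the verdict v.
    record Errs≤ (f : Config → Carrier) (t : ℕ) (c : Config) (b : Carrier) : Set where
      constructor errs≤
      field
        halts       : HaltsWithin t c
        correctness : 1# - b ≤ expectation f (run t c)
    open Errs≤ public

    weaken : ∀ {f t c b b′} → b ≤ b′ → Errs≤ f t c b → Errs≤ f t c b′
    weaken {b = b} {b′} b≤b′ (errs≤ h e) = errs≤ h (≤-trans
      (≤-by (b′ - b) (y≤z⇒0≤z-y b≤b′)
        (solve 2 (λ b b′ → con (+ 1) :- b := con (+ 1) :- b′ :+ (b′ :- b)) ≈-refl b b′)) e)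

    step-rule : ∀ {f t c c′ w b} → step c ≡ [ w , c′ ] → w ≈ 1# →
                Errs≤ f t c′ b → Errs≤ f (suc t) c b
    step-rule {f} {t} {c} {c′} {w} {b} eq w≈1 (errs≤ h e) = errs≤
      (≡.subst (λ d → All (λ (_ , c) → Halted c) (d >>= run t)) (≡.sym eq)
        (support->>= [ w , c′ ] (run t) (h ∷ [])))
      (begin
        1# - b                               ≤⟨ e ⟩
        value c′                          ≈⟨ *-identityˡ _ ⟨
        1# * value c′                     ≈⟨ *-congʳ w≈1 ⟨
        w * value c′                      ≈⟨ +-identityʳ _ ⟨
        expectation value [ w , c′ ]      ≈⟨ expectation->>= f [ w , c′ ] (run t) ⟨
        expectation f ([ w , c′ ] >>= run t)
          ≡⟨ ≡.cong (λ d → expectation f (d >>= run t)) (≡.sym eq) ⟩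
        expectation f (run (suc t) c)               ∎)
      where
      value : Config → Carrier
      value c = expectation f (run t c)

    halted-rule : ∀ {f v b} t → 1# - b ≤ f (halted v) → Errs≤ f t (halted v) b
    halted-rule {f} {v} zero    1-b≤ = errs≤ (halted v ∷ [])
      (≤-trans 1-b≤ (≤-reflexive (≈-sym (expectation-pure f (halted v)))))
    halted-rule         (suc t) 1-b≤ = step-rule ≡.refl ≈-refl (halted-rule t 1-b≤)

    output-rule : ∀ {f v t cs s b} → 1# - b ≤ f (halted v) →
                  Errs≤ f (suc t) (running (output v ∷ cs) s) b
    output-rule {t = t} 1-b≤ = step-rule ≡.refl ≈-refl (halted-rule t 1-b≤)

    block-rule : ∀ {f t cs b} is s → Deterministic is →
                 Errs≤ f t (running cs (effects is s)) b →
                 Errs≤ f (length is ℕ.+ t) (running (List.map exec is ++ cs) s) b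
    block-rule []       s _   e = e
    block-rule (i ∷ is) s (d , ds) e = step-rule
      (≡.cong (_>>= λ s′ → pure (running _ s′)) (execute-deterministic i s d)) (*-identityˡ 1#)
      (block-rule is (effect i s) ds e)

    cond-rule : ∀ {f t cs s x b t-branch f-branch h} → holds x s ≡ h →
                Errs≤ f t (running ((if h then t-branch else f-branch) ++ cs) s) b →
                Errs≤ f (suc t) (running (cond x t-branch f-branch ∷ cs) s) b
    cond-rule ≡.refl = step-rule ≡.refl ≈-refl

    while-rule : ∀ {f t cs s x b body h} → holds x s ≡ h →
                 Errs≤ f t (running (if h then body ++ while x body ∷ cs else cs) s) b →
                 Errs≤ f (suc t) (running (while x body ∷ cs) s) b
    while-rule ≡.refl = step-rule ≡.refl ≈-refl

    query-rule : ∀ {f t cs s b} x y → (∀ i → Errs≤ f t (running cs (setNat s y (suc (toℕ i)))) (b i)) →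
                 Errs≤ f (suc t) (running (exec (query x y) ∷ cs) s) (𝔼 (box x) b)
    query-rule {f} {t} {cs} {s} {b} x y e = errs≤
      (support->>= after (run t)
        (support->>= (sample d >>= answer) continue
          (support->>= (sample d) answer
            (All.tabulate⁺ (λ i → (halts (e i) ∷ []) ∷ [])))))
      (begin
        1# - 𝔼 d b
          ≈⟨ solve 1 (λ b → con (+ 1) :- b := con (+ 1) :+ con (ℤ.- (+ 1)) :* b) ≈-refl _ ⟩
        1# + -1# * 𝔼 d b
          ≈⟨ 𝔼-affine d 1# -1# b ⟨
        𝔼 d (λ i → 1# + -1# * b i)
          ≈⟨ 𝔼-cong d (λ i → solve 1 (λ b → con (+ 1) :+ con (ℤ.- (+ 1)) :* b := con (+ 1) :- b) ≈-refl (b i)) ⟩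
        𝔼 d (λ i → 1# - b i)
          ≤⟨ 𝔼-mono d (λ i → correctness (e i)) ⟩
        𝔼 d (λ i → value (running cs (setNat s y (suc (toℕ i)))))
          ≈⟨ expectation-tabulate (value ∘ resume) (prob d) (suc ∘ toℕ) ⟨
        expectation (λ k → value (resume k)) (sample d)
          ≈⟨ expectation-cong (λ k → expectation-pure (value ∘ running cs) (setNat s y k)) (sample d) ⟨
        expectation (λ k → expectation (value ∘ running cs) (answer k)) (sample d)
          ≈⟨ expectation->>= (value ∘ running cs) (sample d) answer ⟨
        expectation (λ s′ → value (running cs s′)) (sample d >>= answer)
          ≈⟨ expectation-cong (λ s′ → expectation-pure value (running cs s′)) (sample d >>= answer) ⟨
        expectation (λ s′ → expectation value (continue s′)) (sample d >>= answer)
          ≈⟨ expectation->>= value (sample d >>= answer) continue ⟨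
        expectation value after
          ≈⟨ expectation->>= f after (run t) ⟨
        expectation f (run (suc t) (running (exec (query x y) ∷ cs) s)) ∎)
      where
      d = box x
      -1# = fromℤ (ℤ.- (+ 1))
      value : Config → Carrier
      value c = expectation f (run t c)
      answer : ℕ → Dist State
      answer k = pure (setNat s y k)
      continue : State → Dist Config
      continue s′ = pure (running cs s′)
      resume : ℕ → Config
      resume k = running cs (setNat s y k)
      after : Dist Config
      after = sample d >>= answer >>= continue

-- x := [y = z], with natural register 5 as scratch.
equal : NatReg → NatReg → NatReg → List Instr
equal x y z = subₙ x y z ∷ subₙ 5 z y ∷ addₙ x x 5 ∷ constₙ 5 1 ∷ subₙ x 5 x ∷ []

-- Real registers: 2 holds μ = ε² / 128, 3 holds 1, 5 holds 1 - 80μ², 6 holds ρ = 1 - 16μ²,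
-- 7 holds ρᵏ after k rounds, and 8 holds the product of the factors 1 + μ (Z - 80μ).
square-ε : List Instr
square-ε = mulᵣ 2 0 0 ∷ constᵣ 3 2 ∷ []

setup : List Instr
setup =
  constᵣ 3 128 ∷ divᵣ 2 2 3 ∷ constᵣ 3 1 ∷ mulᵣ 4 2 2 ∷
  constᵣ 5 80 ∷ mulᵣ 5 5 4 ∷ subᵣ 5 3 5 ∷
  constᵣ 6 16 ∷ mulᵣ 6 6 4 ∷ subᵣ 6 3 6 ∷
  constᵣ 7 1 ∷ constᵣ 8 1 ∷ []

queries : Program
queries =
  exec (query box-p 0) ∷ exec (query box-p 1) ∷ exec (query box-q 2) ∷ exec (query box-q 3) ∷ []

update : List Instr
update =
  equal 4 0 1 ++ castᵣ 9 4 ∷ equal 4 2 3 ++ castᵣ 10 4 ∷ addᵣ 9 9 10 ∷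
  equal 4 0 2 ++ castᵣ 10 4 ∷ addᵣ 10 10 10 ∷ subᵣ 9 9 10 ∷
  mulᵣ 9 2 9 ∷ addᵣ 9 5 9 ∷ mulᵣ 8 8 9 ∷ mulᵣ 7 7 6 ∷ []

loop : Program
loop =
  while (1 ≤ᵣ 7) (queries ++ List.map exec update) ∷
  cond (8 ≤ᵣ 3) [ output accept ] [ output reject ] ∷ []

tester : Program
tester =
  List.map exec square-ε ++
  cond (3 ≤ᵣ 2) [ output accept ] [] ∷
  List.map exec setup ++ loop

loopTime : ℕ → ℕ
loopTime k = k ℕ.* 30 ℕ.+ 3

module Tester (ℝ : Reals) where
  open Reals ℝ
  open OrderedField ℝ
  open ExpLog ℝ
  open SquareRoot ℝ
  open Semantics ℝ hiding (nonNegative)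
  open Expectation ℝ
  open ProgramLogic ℝ
  open ≤-Reasoning

  module Parameters (δ μ : Carrier) (0≤μ : 0# ≤ μ) (0≤m : 0# ≤ 1# - fromℕ 64 * μ) where

    κ ρ m : Carrier
    κ = 1# - fromℕ 80 * (μ * μ)
    ρ = 1# - fromℕ 16 * (μ * μ)
    m = 1# - fromℕ 64 * μ

    0<ρ : 0# < ρ
    0<ρ ρ≤0 = 0<1 (begin
      1#            ≤⟨ ≤-by _ (+-nonNegative (*-nonNegative 0≤m 0≤1+64μ)
                                (*-nonNegative (fromℕ-nonNegative 4064) (square-nonNegative μ)))
                         (solve 1 (λ μ → con (+ 2) :* (con (+ 1) :- con (+ 16) :* (μ :* μ)) := con (+ 1) :+
                            ((con (+ 1) :- con (+ 64) :* μ) :* (con (+ 1) :+ con (+ 64) :* μ)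
                              :+ con (+ 4064) :* (μ :* μ))) ≈-refl μ) ⟩
      fromℕ 2 * ρ   ≤⟨ *-monoʳ-≤ (fromℕ-nonNegative 2) ρ≤0 ⟩
      fromℕ 2 * 0#  ≈⟨ zeroʳ _ ⟩
      0#            ∎)
      where
      0≤1+64μ : 0# ≤ 1# + fromℕ 64 * μ
      0≤1+64μ = +-nonNegative 0≤1 (*-nonNegative (fromℕ-nonNegative 64) 0≤μ)

    -- The relation _∼_ turns the product u kept by the program into a bound V on the error.
    record Potential (f : Config → Carrier) : Set₁ where
      field
        A B         : Carrier
        _∼_         : Carrier → Carrier → Set
        initially   : 1# ∼ 1#
        round       : ∀ {u V z} → - fromℕ 2 ≤ z → z ≤ fromℕ 2 →
                      u ∼ V → (u * (κ + μ * z)) ∼ (V * (A + B * z))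
        nonNegative : ∀ {u V} → u ∼ V → 0# ≤ V
        if-accept   : ∀ {u V} → u ∼ V → u ≤ 1# → 1# - V ≤ f (halted accept)
        if-reject   : ∀ {u V} → u ∼ V → 1# < u → 1# - V ≤ f (halted reject)

    1-V≤1 : ∀ {V} → 0# ≤ V → 1# - V ≤ 1#
    1-V≤1 {V} 0≤V = ≤-by V 0≤V (solve 1 (λ V → con (+ 1) := con (+ 1) :- V :+ V) ≈-refl V)

    1-V≤0 : ∀ {V} → 1# ≤ V → 1# - V ≤ 0#
    1-V≤0 {V} 1≤V = ≤-by (V - 1#) (y≤z⇒0≤z-y 1≤V)
      (solve 1 (λ V → con (+ 0) := con (+ 1) :- V :+ (V :- con (+ 1))) ≈-refl V)

    module _ {z : Carrier} (-2≤z : - fromℕ 2 ≤ z) (z≤2 : z ≤ fromℕ 2) where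
      P R f g : Carrier
      P = (z - - fromℕ 2) + fromℕ 2 * m + fromℕ 48 * μ
      R = (fromℕ 2 - z) + fromℕ 2 + fromℕ 80 * μ
      f = κ + μ * z
      g = (1# + fromℕ 112 * (μ * μ)) + - μ * z

      0≤P : 0# ≤ P
      0≤P = +-nonNegative (+-nonNegative (y≤z⇒0≤z-y -2≤z) (*-nonNegative (fromℕ-nonNegative 2) 0≤m))
              (*-nonNegative (fromℕ-nonNegative 48) 0≤μ)

      0≤R : 0# ≤ R
      0≤R = +-nonNegative (+-nonNegative (y≤z⇒0≤z-y z≤2) (fromℕ-nonNegative 2))
              (*-nonNegative (fromℕ-nonNegative 80) 0≤μ)

      f-nonNegative : 0# ≤ f
      f-nonNegative = ≤-by (m + fromℕ 60 * μ + μ * P)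
        (+-nonNegative (+-nonNegative 0≤m (*-nonNegative (fromℕ-nonNegative 60) 0≤μ)) (*-nonNegative 0≤μ 0≤P))
        (solve 2 (λ μ z → let m = con (+ 1) :- con (+ 64) :* μ in
           (con (+ 1) :- con (+ 80) :* (μ :* μ)) :+ μ :* z := con (+ 0) :+ (m :+ con (+ 60) :* μ :+
             μ :* ((z :- :- con (+ 2)) :+ con (+ 2) :* m :+ con (+ 48) :* μ))) ≈-refl μ z)

      g-nonNegative : 0# ≤ g
      g-nonNegative = ≤-by (m + fromℕ 60 * μ + μ * R + fromℕ 32 * (μ * μ))
        (+-nonNegative
          (+-nonNegative (+-nonNegative 0≤m (*-nonNegative (fromℕ-nonNegative 60) 0≤μ)) (*-nonNegative 0≤μ 0≤R))
          (*-nonNegative (fromℕ-nonNegative 32) (square-nonNegative μ)))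
        (solve 2 (λ μ z → let m = con (+ 1) :- con (+ 64) :* μ in
           (con (+ 1) :+ con (+ 112) :* (μ :* μ)) :+ :- μ :* z := con (+ 0) :+ (m :+ con (+ 60) :* μ :+
             μ :* ((con (+ 2) :- z) :+ con (+ 2) :+ con (+ 80) :* μ) :+ con (+ 32) :* (μ :* μ))) ≈-refl μ z)

      -- With y = z - 80μ, f * g - 1 = μ² ((16 - y²) + 16 (1 + 2μy)), and P = 4 + y, R = 4 - y.
      1≤fg : 1# ≤ f * g
      1≤fg = ≤-by (μ * μ * (P * R + fromℕ 16 * (m + fromℕ 56 * μ + fromℕ 2 * μ * P)))
        (*-nonNegative (square-nonNegative μ) (+-nonNegative (*-nonNegative 0≤P 0≤R)
          (*-nonNegative (fromℕ-nonNegative 16) (+-nonNegative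
            (+-nonNegative 0≤m (*-nonNegative (fromℕ-nonNegative 56) 0≤μ))
            (*-nonNegative (*-nonNegative (fromℕ-nonNegative 2) 0≤μ) 0≤P)))))
        (solve 2 (λ μ z → let m = con (+ 1) :- con (+ 64) :* μ
                              P = (z :- :- con (+ 2)) :+ con (+ 2) :* m :+ con (+ 48) :* μ
                              R = (con (+ 2) :- z) :+ con (+ 2) :+ con (+ 80) :* μ in
           ((con (+ 1) :- con (+ 80) :* (μ :* μ)) :+ μ :* z) :*
           ((con (+ 1) :+ con (+ 112) :* (μ :* μ)) :+ :- μ :* z) :=
           con (+ 1) :+ μ :* μ :* (P :* R :+ con (+ 16) :* (m :+ con (+ 56) :* μ :+ con (+ 2) :* μ :* P)))
           ≈-refl μ z)

    halting-potential : Potential (λ _ → 1#)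
    halting-potential = record
      { A = 0# ; B = 0# ; _∼_ = λ _ V → 0# ≤ V
      ; initially   = 0≤1
      ; round       = λ {_} {V} {z} _ _ 0≤V → ≤-reflexive
          (solve 2 (λ V z → con (+ 0) := V :* (con (+ 0) :+ con (+ 0) :* z)) ≈-refl V z)
      ; nonNegative = λ 0≤V → 0≤V
      ; if-accept   = λ 0≤V _ → 1-V≤1 0≤V
      ; if-reject   = λ 0≤V _ → 1-V≤1 0≤V
      }

    accept-potential : Potential (outputs accept)
    accept-potential = record
      { A = κ ; B = μ ; _∼_ = λ u V → 0# ≤ u × u ≤ V
      ; initially   = 0≤1 , ≤-refl
      ; round       = λ -2≤z z≤2 (0≤u , u≤V) →
          *-nonNegative 0≤u (f-nonNegative -2≤z z≤2) , *-monoˡ-≤ (f-nonNegative -2≤z z≤2) u≤V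
      ; nonNegative = λ (0≤u , u≤V) → ≤-trans 0≤u u≤V
      ; if-accept   = λ (0≤u , u≤V) _ → 1-V≤1 (≤-trans 0≤u u≤V)
      ; if-reject   = λ (_ , u≤V) 1<u → 1-V≤0 (≤-trans (<⇒≤ 1<u) u≤V)
      }

    reject-potential : Potential (outputs reject)
    reject-potential = record
      { A = 1# + fromℕ 112 * (μ * μ) ; B = - μ ; _∼_ = λ u V → 0# ≤ V × 1# ≤ u * V
      ; initially   = 0≤1 , ≤-reflexive (≈-sym (*-identityˡ 1#))
      ; round       = λ {u} {V} -2≤z z≤2 (0≤V , 1≤uV) →
          *-nonNegative 0≤V (g-nonNegative -2≤z z≤2) , (begin
            1#                 ≈⟨ *-identityˡ 1# ⟨
            1# * 1#            ≤⟨ *-mono-≤ 0≤1 (≤-trans 0≤1 (1≤fg -2≤z z≤2)) 1≤uV (1≤fg -2≤z z≤2) ⟩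
            (u * V) * (_ * _)  ≈⟨ solve 4 (λ u V f g → (u :* V) :* (f :* g) :=
                                    (u :* f) :* (V :* g)) ≈-refl u V _ _ ⟩
            (u * _) * (V * _)  ∎)
      ; nonNegative = proj₁
      ; if-accept   = λ {u} {V} (0≤V , 1≤uV) u≤1 → 1-V≤0 (begin
          1#      ≤⟨ 1≤uV ⟩
          u * V   ≤⟨ *-monoˡ-≤ 0≤V u≤1 ⟩
          1# * V  ≈⟨ *-identityˡ V ⟩
          V       ∎)
      ; if-reject   = λ (0≤V , _) _ → 1-V≤1 0≤V
      }

    record AtLoop (s : State) (w u : Carrier) : Set where
      field
        real-1 : real s 1 ≈ δ
        real-2 : real s 2 ≈ μ
        real-3 : real s 3 ≈ 1#
        real-5 : real s 5 ≈ κ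
        real-6 : real s 6 ≈ ρ
        real-7 : real s 7 ≈ w
        real-8 : real s 8 ≈ u

    sampled : State → ℕ → ℕ → ℕ → ℕ → State
    sampled s i i′ j j′ = setNat (setNat (setNat (setNat s 0 i) 1 i′) 2 j) 3 j′

    estimate-bounds : ∀ {n} (i i′ j j′ : Fin n) →
      (- fromℕ 2 ≤ estimate i i′ j j′) × (estimate i i′ j j′ ≤ fromℕ 2)
    estimate-bounds i i′ j j′ =
      ≤-by (collision i i′ + collision j j′ + ((1# - collision i j) + (1# - collision i j)))
        (+-nonNegative (+-nonNegative (0≤ i i′) (0≤ j j′)) (+-nonNegative (≤1 i j) (≤1 i j)))
        (solve 3 (λ a b c → a :+ b :- (c :+ c) := :- con (+ 2) :+
           (a :+ b :+ ((con (+ 1) :- c) :+ (con (+ 1) :- c)))) ≈-refl _ _ _) ,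
      ≤-by ((1# - collision i i′) + (1# - collision j j′) + (collision i j + collision i j))
        (+-nonNegative (+-nonNegative (≤1 i i′) (≤1 j j′)) (+-nonNegative (0≤ i j) (0≤ i j)))
        (solve 3 (λ a b c → con (+ 2) := a :+ b :- (c :+ c) :+
           ((con (+ 1) :- a) :+ (con (+ 1) :- b) :+ (c :+ c))) ≈-refl _ _ _)
      where
      0≤ : ∀ i j → 0# ≤ collision i j
      0≤ i j = fromℕ-nonNegative (same (toℕ i) (toℕ j))
      ≤1 : ∀ i j → 0# ≤ 1# - collision i j
      ≤1 i j = y≤z⇒0≤z-y (same≤1 (toℕ i) (toℕ j))

    at-loop-again : ∀ {s w u n} (i i′ j j′ : Fin n) → AtLoop s w u →
      AtLoop (effects update (sampled s (suc (toℕ i)) (suc (toℕ i′)) (suc (toℕ j)) (suc (toℕ j′))))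
             (w * ρ) (u * (κ + μ * estimate i i′ j j′))
    at-loop-again i i′ j j′ inv = record
      { real-1 = real-1
      ; real-2 = real-2
      ; real-3 = real-3
      ; real-5 = real-5
      ; real-6 = real-6
      ; real-7 = *-cong real-7 real-6
      ; real-8 = *-cong real-8 (+-cong real-5 (*-congʳ real-2))
      }
      where open AtLoop inv

    module Analysis {n : ℕ} (p q : Distribution n)
                    {f : Config → Carrier} (potential : Potential f)
                    (drift : Potential.A potential + Potential.B potential * distance² p q ≤ ρ) where
      open Potential potential
      open Run p q

      verdict-rule : ∀ {t s w u V b} → AtLoop s w u → u ∼ V → V ≤ b →
                     Errs≤ p q f (2 ℕ.+ t) (running [ cond (8 ≤ᵣ 3) [ output accept ] [ output reject ] ] s) b
      verdict-rule {s = s} at u∼V V≤b with real s 8 ≤? real s 3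
      ... | yes u≤1 = cond-rule p q (dec-true (real s 8 ≤? real s 3) u≤1) (weaken p q V≤b (output-rule p q
          (if-accept u∼V (≤-trans (≤-reflexive (≈-sym real-8)) (≤-trans u≤1 (≤-reflexive real-3))))))
        where open AtLoop at
      ... | no  1<u = cond-rule p q (dec-false (real s 8 ≤? real s 3) 1<u) (weaken p q V≤b (output-rule p q
          (if-reject u∼V (λ u≤1 →
            1<u (≤-trans (≤-reflexive real-8) (≤-trans u≤1 (≤-reflexive (≈-sym real-3))))))))
        where open AtLoop at

      exit-rule : ∀ {t s w u V c} → AtLoop s w u → u ∼ V → 0# < w → δ ≤ c * w → w < δ →
                  Errs≤ p q f (3 ℕ.+ t) (running loop s) (V * c)
      exit-rule {t} {s} {w} {u} {V} {c} at u∼V 0<w δ≤cw w<δ =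
        while-rule p q (dec-false (real s 1 ≤? real s 7) δ≰w)
          (verdict-rule at u∼V V≤Vc)
        where
        open AtLoop at
        0≤V = nonNegative u∼V
        δ≰w : ¬ (real s 1 ≤ real s 7)
        δ≰w δ≤w = w<δ (≤-trans (≤-reflexive (≈-sym real-1)) (≤-trans δ≤w (≤-reflexive real-7)))
        1≤c : 1# ≤ c
        1≤c = *-cancelˡ-≤ 0<w (begin
          w * 1#  ≈⟨ *-identityʳ w ⟩
          w       ≤⟨ <⇒≤ w<δ ⟩
          δ       ≤⟨ δ≤cw ⟩
          c * w   ≈⟨ *-comm c w ⟩
          w * c   ∎)
        V≤Vc : V ≤ V * c
        V≤Vc = ≤-trans (≤-reflexive (≈-sym (*-identityʳ V))) (*-monoʳ-≤ 0≤V 1≤c)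

      round-drift : ∀ {V c} → 0# ≤ V → 0# ≤ c →
        𝔼 p (λ i → 𝔼 p (λ i′ → 𝔼 q (λ j → 𝔼 q (λ j′ →
          V * A * (c / ρ) + V * B * (c / ρ) * estimate i i′ j j′)))) ≤ V * c
      round-drift {V} {c} 0≤V 0≤c = begin
        _
          ≈⟨ estimate-unbiased p q (V * A * (c / ρ)) (V * B * (c / ρ)) ⟩
        V * A * (c / ρ) + V * B * (c / ρ) * D
          ≈⟨ solve 5 (λ V A B C D → V :* A :* C :+ V :* B :* C :* D := V :* C :* (A :+ B :* D))
               ≈-refl V A B (c / ρ) D ⟩
        V * (c / ρ) * (A + B * D)
          ≤⟨ *-monoʳ-≤ (*-nonNegative 0≤V (/-nonNegative 0≤c 0<ρ)) drift ⟩
        V * (c / ρ) * ρ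
          ≈⟨ *-assoc V (c / ρ) ρ ⟩
        V * (c / ρ * ρ)
          ≈⟨ *-congˡ (/-cancel 0<ρ) ⟩
        V * c ∎
        where D = distance² p q

      loop-rule : ∀ k {s w u V c} → AtLoop s w u → u ∼ V → 0# < w → 0# ≤ c → δ ≤ c * w → w * ρ ^ k < δ →
                  Errs≤ p q f (loopTime k) (running loop s) (V * c)
      loop-rule zero {w = w} at u∼V 0<w 0≤c δ≤cw wρᵏ<δ =
        exit-rule at u∼V 0<w δ≤cw (≤-<-trans (≤-reflexive (≈-sym (*-identityʳ w))) wρᵏ<δ)
      loop-rule (suc k) {s} {w} {u} {V} {c} at u∼V 0<w 0≤c δ≤cw wρᵏ<δ with δ ≤? w
      ... | no  w<δ = exit-rule at u∼V 0<w δ≤cw w<δ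
      ... | yes δ≤w = weaken p q (round-drift (nonNegative u∼V) 0≤c)
        (while-rule p q (dec-true (real s 1 ≤? real s 7) proceed)
          (query-rule p q box-p 0 (λ i → query-rule p q box-p 1 (λ i′ →
           query-rule p q box-q 2 (λ j → query-rule p q box-q 3 (λ j′ →
             block-rule p q update _ _ (weaken p q (rearrange i i′ j j′)
               (loop-rule k (at-loop-again i i′ j j′ at)
                 (round (proj₁ (estimate-bounds i i′ j j′)) (proj₂ (estimate-bounds i i′ j j′)) u∼V)
                 (*-positive 0<w 0<ρ) (/-nonNegative 0≤c 0<ρ) δ≤c′w′ w′ρᵏ<δ))))))))
        where
        open AtLoop at
        proceed : real s 1 ≤ real s 7
        proceed = ≤-trans (≤-reflexive real-1) (≤-trans δ≤w (≤-reflexive (≈-sym real-7)))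
        δ≤c′w′ : δ ≤ c / ρ * (w * ρ)
        δ≤c′w′ = begin
          δ                  ≤⟨ δ≤cw ⟩
          c * w              ≈⟨ *-congʳ (/-cancel 0<ρ) ⟨
          c / ρ * ρ * w      ≈⟨ solve 3 (λ c r w → c :* r :* w := c :* (w :* r)) ≈-refl (c / ρ) ρ w ⟩
          c / ρ * (w * ρ)    ∎
        w′ρᵏ<δ : w * ρ * ρ ^ k < δ
        w′ρᵏ<δ = ≤-<-trans (≤-reflexive (*-assoc w ρ (ρ ^ k))) wρᵏ<δ
        rearrange : ∀ i i′ j j′ → V * (A + B * estimate i i′ j j′) * (c / ρ) ≤
                    V * A * (c / ρ) + V * B * (c / ρ) * estimate i i′ j j′
        rearrange i i′ j j′ = ≤-reflexive (solve 5 (λ V A B C z →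
          V :* (A :+ B :* z) :* C := V :* A :* C :+ V :* B :* C :* z) ≈-refl V A B (c / ρ) (estimate i i′ j j′))

  C : Carrier
  C = fromℕ 48 + fromℕ 30 * (fromℕ 8 * fromℕ 128)

  runTime : ℕ → ℕ
  runTime k = 45 ℕ.+ (k ℕ.* 30 ℕ.+ 3)

  runTime-bound : ∀ k {x} → 0# ≤ x → fromℕ k ≤ fromℕ 8 * fromℕ 128 * x → fromℕ (runTime k) ≤ C * (1# + x)
  runTime-bound k {x} 0≤x k≤ = begin
    fromℕ (runTime k)
      ≈⟨ ≈-trans (fromℕ-+ 45 (k ℕ.* 30 ℕ.+ 3)) (+-congˡ (≈-trans (fromℕ-+ (k ℕ.* 30) 3) (+-congʳ (fromℕ-* k 30)))) ⟩
    fromℕ 45 + (fromℕ k * fromℕ 30 + fromℕ 3)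
      ≤⟨ +-monoʳ-≤ (fromℕ 45) (+-mono-≤ (*-monoˡ-≤ (fromℕ-nonNegative 30) k≤) ≤-refl) ⟩
    fromℕ 45 + (fromℕ 8 * fromℕ 128 * x * fromℕ 30 + fromℕ 3)
      ≤⟨ ≤-by (fromℕ 48 * x + fromℕ 30 * (fromℕ 8 * fromℕ 128))
           (+-nonNegative (*-nonNegative (fromℕ-nonNegative 48) 0≤x)
             (*-nonNegative (fromℕ-nonNegative 30) (*-nonNegative (fromℕ-nonNegative 8) (fromℕ-nonNegative 128))))
           (solve 2 (λ x e → (con (+ 48) :+ con (+ 30) :* e) :* (con (+ 1) :+ x) :=
             con (+ 45) :+ (e :* x :* con (+ 30) :+ con (+ 3)) :+ (con (+ 48) :* x :+ con (+ 30) :* e))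
             ≈-refl x (fromℕ 8 * fromℕ 128)) ⟩
    C * (1# + x) ∎

  module _ {ε δ : Carrier} (0<ε : 0# < ε) (0<δ : 0# < δ) (δ<1 : δ < 1#) where

    L X : Carrier
    L = log (1# / δ)
    X = (ε ⁻¹) ^ 4 * L

    1≤1/δ : 1# ≤ 1# / δ
    1≤1/δ = ≤-/ 0<δ (≤-trans (≤-reflexive (*-identityˡ δ)) (<⇒≤ δ<1))

    0≤L : 0# ≤ L
    0≤L = log-nonNegative 1≤1/δ

    0≤X : 0# ≤ X
    0≤X = *-nonNegative (^-nonNegative 4 (<⇒≤ (⁻¹-positive 0<ε))) 0≤L

    Verified : ℕ → Set
    Verified T =
      (fromℕ T ≤ C * (1# + X)) ×
      (∀ (n : ℕ) (p q : Distribution n) →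
        let open Run p q
            distance = ‖ (λ i → prob p i - prob q i) ‖₂
        in
        HaltsWithin T (initial tester ε δ) ×
        (distance ≤ ε / fromℕ 2 → 1# - δ ≤ Pr[ accept within T ] (initial tester ε δ)) ×
        (ε < distance → 1# - δ ≤ Pr[ reject within T ] (initial tester ε δ)))

    εε<distance² : ∀ {n} (p q : Distribution n) →
      ε < ‖ (λ i → prob p i - prob q i) ‖₂ → ε * ε < distance² p q
    εε<distance² p q = <√⇒square< (<⇒≤ 0<ε) (distance²-nonNegative p q)

    module _ (2≤εε : fromℕ 2 ≤ ε * ε) where

      immediate : ∀ {n} (p q : Distribution n) → Errs≤ p q (outputs accept) (runTime 0) (initial tester ε δ) 0#
      immediate p q = block-rule p q square-ε _ _ (cond-rule p q (dec-true (fromℕ 2 ≤? ε * ε) 2≤εε)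
        (output-rule p q (≤-by 0# ≤-refl (solve 0 (con (+ 1) := con (+ 1) :- con (+ 0) :+ con (+ 0)) ≈-refl))))

      verified-large : Verified (runTime 0)
      verified-large =
        runTime-bound 0 0≤X (*-nonNegative (*-nonNegative (fromℕ-nonNegative 8) (fromℕ-nonNegative 128)) 0≤X) ,
        λ n p q →
          halts (immediate p q) ,
          (λ _ → correctness (weaken p q (<⇒≤ 0<δ) (immediate p q))) ,
          (λ ε<dist → ⊥-elim (εε<distance² p q ε<dist (≤-trans (distance²≤2 p q) 2≤εε)))

    module _ (εε<2 : ε * ε < fromℕ 2) where

      h μ η : Carrier
      h = fromℕ 128 ⁻¹
      μ = ε * ε / fromℕ 128
      η = fromℕ 16 * (μ * μ)

      128μ≈εε : fromℕ 128 * μ ≈ ε * ε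
      128μ≈εε = ≈-trans (*-comm _ _) (/-cancel (fromℕ-positive 127))

      0<μ : 0# < μ
      0<μ = *-positive (*-positive 0<ε 0<ε) (⁻¹-positive (fromℕ-positive 127))

      0<η : 0# < η
      0<η = *-positive (fromℕ-positive 15) (*-positive 0<μ 0<μ)

      0≤1-64μ : 0# ≤ 1# - fromℕ 64 * μ
      0≤1-64μ = *-cancelˡ-≤ (fromℕ-positive 1) (begin
        fromℕ 2 * 0#                    ≈⟨ zeroʳ _ ⟩
        0#                              ≤⟨ y≤z⇒0≤z-y (<⇒≤ εε<2) ⟩
        fromℕ 2 - ε * ε                 ≈⟨ +-congˡ (-‿cong 128μ≈εε) ⟨
        fromℕ 2 - fromℕ 128 * μ         ≈⟨ solve 1 (λ μ → con (+ 2) :- con (+ 128) :* μ :=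
                                             con (+ 2) :* (con (+ 1) :- con (+ 64) :* μ)) ≈-refl μ ⟩
        fromℕ 2 * (1# - fromℕ 64 * μ)   ∎)

      open Parameters δ μ (<⇒≤ 0<μ) 0≤1-64μ

      K : ℕ
      K = proj₁ (floor (/-nonNegative 0≤L 0<η))

      Kη≤L : fromℕ K * η ≤ L
      Kη≤L = ≤-trans (*-monoˡ-≤ (<⇒≤ 0<η) (proj₁ (proj₂ (floor (/-nonNegative 0≤L 0<η)))))
                     (≤-reflexive (/-cancel 0<η))

      L<[1+K]η : L < fromℕ (suc K) * η
      L<[1+K]η [1+K]η≤L = proj₂ (proj₂ (floor (/-nonNegative 0≤L 0<η))) (≤-/ 0<η [1+K]η≤L)

      K≤ : fromℕ K ≤ fromℕ 8 * fromℕ 128 * X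
      K≤ = begin
        fromℕ K
          ≈⟨ ≈-trans (*-congˡ (unit (unit (unit ει≈1 ει≈1) (unit ει≈1 ει≈1)) (unit 128h≈1 128h≈1))) (*-identityʳ _) ⟨
        fromℕ K * (ε * ι * (ε * ι) * (ε * ι * (ε * ι)) * (fromℕ 128 * h * (fromℕ 128 * h)))
          ≈⟨ solve 4 (λ k ε ι h →
               k :* (ε :* ι :* (ε :* ι) :* (ε :* ι :* (ε :* ι)) :* (con (+ 128) :* h :* (con (+ 128) :* h))) :=
               con (+ 8) :* con (+ 128) :* (ι :* (ι :* (ι :* (ι :* con (+ 1)))) :*
                 (k :* (con (+ 16) :* (ε :* ε :* h :* (ε :* ε :* h)))))) ≈-refl (fromℕ K) ε ι h ⟩
        fromℕ 8 * fromℕ 128 * (ι ^ 4 * (fromℕ K * η))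
          ≤⟨ *-monoʳ-≤ (*-nonNegative (fromℕ-nonNegative 8) (fromℕ-nonNegative 128))
               (*-monoʳ-≤ (^-nonNegative 4 (<⇒≤ (⁻¹-positive 0<ε))) Kη≤L) ⟩
        fromℕ 8 * fromℕ 128 * X ∎
        where
        ι = ε ⁻¹
        ει≈1 : ε * ι ≈ 1#
        ει≈1 = ⁻¹-inverse (>⇒≉ 0<ε)
        128h≈1 : fromℕ 128 * h ≈ 1#
        128h≈1 = ⁻¹-inverse (>⇒≉ (fromℕ-positive 127))
        unit : ∀ {x y} → x ≈ 1# → y ≈ 1# → x * y ≈ 1#
        unit x≈1 y≈1 = ≈-trans (*-cong x≈1 y≈1) (*-identityˡ 1#)

      module _ {n : ℕ} (p q : Distribution n) where

        D : Carrier
        D = distance² p q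

        entire-run : ∀ {f} (potential : Potential f) →
          Potential.A potential + Potential.B potential * D ≤ ρ →
          Errs≤ p q f (runTime K) (initial tester ε δ) δ
        entire-run potential drift =
          block-rule p q square-ε _ _ (cond-rule p q (dec-false (fromℕ 2 ≤? ε * ε) εε<2)
            (block-rule p q setup _ _ (weaken p q (≤-reflexive (*-identityˡ δ))
              (loop-rule (suc K) at-start initially 0<1 (<⇒≤ 0<δ)
                (≤-reflexive (≈-sym (*-identityʳ δ)))
                (≤-<-trans (≤-reflexive (*-identityˡ _)) ρᴺ<δ)))))
          where
          open Potential potential
          open Analysis p q potential drift
          ρᴺ<δ : ρ ^ suc K < δ
          ρᴺ<δ = geometric-decay (suc K) (<⇒≤ 0<η) (<⇒≤ 0<ρ) 0<δ (<⇒≤ δ<1) L<[1+K]η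
          at-start = record
            { real-1 = ≈-refl
            ; real-2 = ≈-refl
            ; real-3 = fromℕ-1
            ; real-5 = +-congʳ fromℕ-1
            ; real-6 = +-congʳ fromℕ-1
            ; real-7 = fromℕ-1
            ; real-8 = fromℕ-1
            }

        accept-drift : D ≤ ε / fromℕ 2 * (ε / fromℕ 2) → κ + μ * D ≤ ρ
        accept-drift D≤ = ≤-by (μ * (fromℕ 32 * μ - D) + fromℕ 32 * (μ * μ))
          (+-nonNegative (*-nonNegative (<⇒≤ 0<μ) (y≤z⇒0≤z-y D≤32μ))
            (*-nonNegative (fromℕ-nonNegative 32) (square-nonNegative μ)))
          (solve 2 (λ μ D → con (+ 1) :- con (+ 16) :* (μ :* μ) :=
             con (+ 1) :- con (+ 80) :* (μ :* μ) :+ μ :* D :+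
               (μ :* (con (+ 32) :* μ :- D) :+ con (+ 32) :* (μ :* μ))) ≈-refl μ D)
          where
          ε/2 = ε / fromℕ 2
          D≤32μ : D ≤ fromℕ 32 * μ
          D≤32μ = *-cancelˡ-≤ (fromℕ-positive 3) (begin
            fromℕ 4 * D               ≤⟨ *-monoʳ-≤ (fromℕ-nonNegative 4) D≤ ⟩
            fromℕ 4 * (ε/2 * ε/2)     ≈⟨ solve 1 (λ x → con (+ 4) :* (x :* x) :=
                                           x :* con (+ 2) :* (x :* con (+ 2))) ≈-refl ε/2 ⟩
            ε/2 * fromℕ 2 * (ε/2 * fromℕ 2)
                                      ≈⟨ *-cong (/-cancel (fromℕ-positive 1)) (/-cancel (fromℕ-positive 1)) ⟩
            ε * ε                     ≈⟨ 128μ≈εε ⟨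
            fromℕ 128 * μ             ≈⟨ solve 1 (λ μ → con (+ 128) :* μ :=
                                           con (+ 4) :* (con (+ 32) :* μ)) ≈-refl μ ⟩
            fromℕ 4 * (fromℕ 32 * μ)  ∎)

        reject-drift : ε * ε < D → (1# + fromℕ 112 * (μ * μ)) + - μ * D ≤ ρ
        reject-drift εε<D = ≤-by (μ * (D - fromℕ 128 * μ))
          (*-nonNegative (<⇒≤ 0<μ) (y≤z⇒0≤z-y (≤-trans (≤-reflexive 128μ≈εε) (<⇒≤ εε<D))))
          (solve 2 (λ μ D → con (+ 1) :- con (+ 16) :* (μ :* μ) :=
             (con (+ 1) :+ con (+ 112) :* (μ :* μ)) :+ :- μ :* D :+ μ :* (D :- con (+ 128) :* μ)) ≈-refl μ D)

        halting-drift : 0# + 0# * D ≤ ρ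
        halting-drift = ≤-trans
          (≤-reflexive (solve 1 (λ D → con (+ 0) :+ con (+ 0) :* D := con (+ 0)) ≈-refl D)) (<⇒≤ 0<ρ)

      verified-small : Verified (runTime K)
      verified-small = runTime-bound K 0≤X K≤ , λ n p q →
        halts (entire-run p q halting-potential (halting-drift p q)) ,
        (λ dist≤ → correctness (entire-run p q accept-potential
          (accept-drift p q (√≤⇒≤square (*-positive 0<ε (⁻¹-positive (fromℕ-positive 1))) dist≤)))) ,
        (λ ε<dist → correctness (entire-run p q reject-potential
          (reject-drift p q (εε<distance² p q ε<dist))))

    verified : ∃[ T ] Verified T
    verified with fromℕ 2 ≤? ε * ε
    ... | yes 2≤εε = runTime 0 , verified-large 2≤εε
    ... | no  εε<2 = runTime (K εε<2) , verified-small εε<2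

theorem2 : (ℝ : Reals) →
    let open Reals ℝ
        open Semantics ℝ
    in
    ∃[ test ] ∃[ C ] ∀ (ε δ : Carrier) → 0# < ε → 0# < δ → δ < 1# →
      ∃[ T ] (fromℕ T ≤ C * (1# + (ε ⁻¹) ^ 4 * log (1# / δ))) ×
        (∀ (n : ℕ) (p q : Distribution n) →
          let open Run p q
              distance = ‖ (λ i → prob p i - prob q i) ‖₂
          in
          HaltsWithin T (initial test ε δ) ×
          (distance ≤ ε / fromℕ 2 → 1# - δ ≤ Pr[ accept within T ] (initial test ε δ)) ×
          (ε < distance → 1# - δ ≤ Pr[ reject within T ] (initial test ε δ)))
theorem2 ℝ = tester , C , λ _ _ → verified
  where open Tester ℝ
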